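{- Let $r\geq 3$ and $n\geq 2r+2$ be integers. If $\mathcal{H}\subseteq\binom{[n]}{r}$ is an intersecting $r$-uniform hypergraph, then $\sigma_r(\mathcal{H})\leq r\binom{n-2}{r-2}$. Moreover, equality holds only when $\mathcal{H}$ is a $1$-star.
   Context: An $r$-uniform hypergraph $\mathcal{H}\subseteq\binom{[n]}{r}$ on vertex set $[n]=\{1,\dots,n\}$ is a family of $r$-subsets of $[n]$ (its edges). The degree $\deg(v)$ of a vertex $v$ is the number of edges containing $v$. For an $r$-set $S\subseteq[n]$, $\deg(S)=\sum_{v\in S}\deg(v)$. The Ore-degree $\sigma_r(\mathcal{H})$ is the minimum of $\deg(S)$ over all $r$-subsets $S\subseteq[n]$ with $S\notin\mathcal{H}$. $\mathcal{H}$ is intersecting if every two edges have nonempty intersection. A $1$-star is the hypergraph consisting of all $r$-subsets of $[n]$ containing a fixed vertex $x\in[n]$. -}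

module Defs where

open import Data.Nat using (ℕ; _≤_; _∸_; _*_)
open import Data.Nat.Combinatorics using (_C_)
open import Data.Fin using (Fin)
open import Data.Fin.Subset using (Subset; _∈_; _∩_; ∣_∣; Nonempty)
open import Data.Fin.Subset.Properties using (_∈?_)
open import Data.List using (List; length; filter; map; allFin)
open import Data.Nat.ListAction using (sum)
open import Data.List.Relation.Unary.Unique.Propositional using (Unique)
import Data.List.Membership.Propositional as L
open import Data.Product using (Σ; _×_; ∃)
open import Relation.Binary.PropositionalEquality using (_≡_)
open import Relation.Nullary using (¬_)
open import Function.Bundles using (_⇔_)

record Hypergraph (n r : ℕ) : Set where
  field
    edges   : List (Subset n)
    unique  : Unique edges
    uniform : ∀ {e} → e L.∈ edges → ∣ e ∣ ≡ r
open Hypergraph public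

deg : ∀ {n r} → Hypergraph n r → Fin n → ℕ
deg H v = length (filter (λ e → v ∈? e) (edges H))

degSet : ∀ {n r} → Hypergraph n r → Subset n → ℕ
degSet H S = sum (map (deg H) (filter (λ v → v ∈? S) (allFin _)))

NonEdge : ∀ {n r} → Hypergraph n r → Subset n → Set
NonEdge {r = r} H S = (∣ S ∣ ≡ r) × ¬ (S L.∈ edges H)

IsOreDegree : ∀ {n r} → Hypergraph n r → ℕ → Set
IsOreDegree H m =
  (Σ (Subset _) λ S → NonEdge H S × degSet H S ≡ m)
  × (∀ S → NonEdge H S → m ≤ degSet H S)

Intersecting : ∀ {n r} → Hypergraph n r → Set
Intersecting H = ∀ {e f} → e L.∈ edges H → f L.∈ edges H → Nonempty (e ∩ f)

IsOneStar : ∀ {n r} → Hypergraph n r → Set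
IsOneStar {n} {r} H = ∃ λ (x : Fin n) →
  ∀ (S : Subset n) → (S L.∈ edges H) ⇔ ((∣ S ∣ ≡ r) × x ∈ S)

{-# OPTIONS --safe #-}
module Submission where

-- Let f be the indicator of H, of size h, on the r-subsets of [n], and write c₁ = C(n−1,r−1), m = n − 2r. An
-- affine function S ↦ b + Σ_{v ∈ S} w_v on r-subsets is subtracted from a multiple of f so that the remainder g
-- is orthogonal to all affine functions. On such g the disjointness operator g ↦ (F ↦ Σ_{E ∩ F = ∅} g(E)) has norm
-- at most C(n−r−2,r−2): up to m! it is m applications of the lattice operator up, followed by complementation, and
-- one application of up at level s multiplies the squared norm by at most (s−1)(n−s−2), by induction on s from
-- down ∘ up − up ∘ down = n − 2s. As H is intersecting, the disjointness form vanishes at f, which gives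
-- ‖g‖² ≤ const · h (c₁ − h). On the other hand, if every non-edge has degree at least r C(n−2,r−2), then averaging
-- deg(S) over the non-edges bounds Σ deg(v)² from above, that is ‖g‖² ≥ const · (n c₁ − r h)(c₁ − h). For n ≥ 2r + 2
-- the two bounds are compatible only if h = c₁ and g = 0, and then f is affine, which forces a star.

open import Defs
open import Data.Bool.Base using (if_then_else_)
open import Data.Bool.Properties using () renaming (_≟_ to _≟ᵇ_)
open import Data.Fin.Base using (Fin; zero; suc)
import Data.Fin.Properties as Fin
open import Data.Fin.Subset using (Subset; Side; inside; outside; ∁; ⊥; _⊆_; ∣_∣; _∈_; _∉_; ⁅_⁆)
open import Data.Fin.Subset.Properties
open import Data.Integer.Base hiding (suc; ∣_∣)
open import Data.Integer.Properties
open import Data.Integer.Tactic.RingSolver using (solve-∀)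
open import Data.List.Base using (List; []; _∷_; length; filter; map; tabulate)
import Data.List.Membership.DecPropositional as DecMembership
import Data.List.Membership.Propositional as L
import Data.List.Relation.Unary.All as All
open import Data.List.Relation.Unary.AllPairs using (_∷_)
open import Data.List.Relation.Unary.Any using (here; there)
open import Data.List.Relation.Unary.Unique.Propositional using (Unique)
open import Data.Nat.Base as ℕ using (ℕ; zero; suc; _∸_)
open import Data.Nat.Combinatorics using (_C_; k>n⇒nCk≡0; nCk+nC[k+1]≡[n+1]C[k+1])
open import Data.Nat.ListAction using (sum)
import Data.Nat.Properties as ℕₚ
import Data.Nat.Tactic.RingSolver as ℕ-Solver
open import Data.Product using (Σ; ∃; _×_; _,_; proj₁; proj₂)
open import Data.Sum using (inj₁; inj₂)
open import Data.Vec.Base using ([]; _∷_; here; lookup; _[_]≔_)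
open import Data.Vec.Properties using (≡-dec; lookup∘update; lookup∘update′; lookup⇒[]=; []=⇒lookup)
open import Function using (_∘_; mk⇔)
open import Relation.Binary.PropositionalEquality
open import Relation.Nullary using (Dec; yes; no; does; ¬_; contradiction)
open import Relation.Nullary.Decidable using (_×-dec_; ¬?)

private variable
  n r : ℕ

-- The projection of `f` off the affine functions has denominator `ν * q * c₁`; `g` is this
-- projection multiplied by it, which keeps everything in ℤ. No eigenspaces are constructed: the
-- norm bound alternates between `up` and `down`, which are adjoint and hence equally bounded, and
-- starts from the vanishing of orthogonal functions at level one. The two estimates compare ‖g‖²,
-- up to a common factor, with multiples of h D and of (n c₁ - r h) D, where the sign of D = c₁ - h
-- is not yet known. Once the constants agree, (n - r) h - (n c₁ - r h) = -n D makes the difference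
-- a negative multiple of D², so D = 0. Making the constants agree costs k + m ≤ k m for k = r - 1
-- and m = n - 2r, that is (r - 2)(n - 2r - 1) ≥ 1, which is what r ≥ 3 and n ≥ 2r + 2 provide.

swap-middle : ∀ a b c d → a + b + (c + d) ≡ a + c + (b + d)
swap-middle = solve-∀

square-nonneg : ∀ i → 0ℤ ≤ i * i
square-nonneg (+ n) = subst (0ℤ ≤_) (pos-* n n) (+≤+ ℕ.z≤n)
square-nonneg -[1+ n ] = +≤+ ℕ.z≤n

square-zero : ∀ i → i * i ≡ 0ℤ → i ≡ 0ℤ
square-zero i eq with i*j≡0⇒i≡0∨j≡0 i eq
... | inj₁ p = p
... | inj₂ p = p

-- Sums and inner products over the Boolean cube

out inn : (Subset (suc n) → ℤ) → Subset n → ℤ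
out φ S = φ (outside ∷ S)
inn φ S = φ (inside ∷ S)

nonneg-sum-zero : ∀ {i j} → 0ℤ ≤ i → 0ℤ ≤ j → i + j ≡ 0ℤ → i ≡ 0ℤ × j ≡ 0ℤ
nonneg-sum-zero {+ zero} {+ j} p q eq = refl , eq
nonneg-sum-zero {+ suc i} {+ j} p q ()

opaque
  ∑ : (Subset n → ℤ) → ℤ
  ∑ {zero} φ = φ []
  ∑ {suc n} φ = ∑ (out φ) + ∑ (inn φ)

opaque
  unfolding ∑

  ∑-empty : (φ : Subset 0 → ℤ) → ∑ φ ≡ φ []
  ∑-empty φ = refl

  ∑-split : (φ : Subset (suc n) → ℤ) → ∑ φ ≡ ∑ (out φ) + ∑ (inn φ)
  ∑-split φ = refl

  ∑-cong : {φ ψ : Subset n → ℤ} → (∀ S → φ S ≡ ψ S) → ∑ φ ≡ ∑ ψ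
  ∑-cong {zero} eq = eq []
  ∑-cong {suc n} eq = cong₂ _+_ (∑-cong (λ S → eq (outside ∷ S))) (∑-cong (λ S → eq (inside ∷ S)))

  ∑-+ : (φ ψ : Subset n → ℤ) → ∑ (λ S → φ S + ψ S) ≡ ∑ φ + ∑ ψ
  ∑-+ {zero} φ ψ = refl
  ∑-+ {suc n} φ ψ = trans (cong₂ _+_ (∑-+ (out φ) (out ψ)) (∑-+ (inn φ) (inn ψ)))
    (swap-middle (∑ (out φ)) (∑ (out ψ)) (∑ (inn φ)) (∑ (inn ψ)))

  ∑-* : ∀ c (φ : Subset n → ℤ) → ∑ (λ S → c * φ S) ≡ c * ∑ φ
  ∑-* {zero} c φ = refl
  ∑-* {suc n} c φ = trans (cong₂ _+_ (∑-* c (out φ)) (∑-* c (inn φ)))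
    (sym (*-distribˡ-+ c (∑ (out φ)) (∑ (inn φ))))

  ∑-0 : {φ : Subset n → ℤ} → (∀ S → φ S ≡ 0ℤ) → ∑ φ ≡ 0ℤ
  ∑-0 {zero} eq = eq []
  ∑-0 {suc n} eq = cong₂ _+_ (∑-0 (λ S → eq (outside ∷ S))) (∑-0 (λ S → eq (inside ∷ S)))

  ∑-nonneg : {φ : Subset n → ℤ} → (∀ S → 0ℤ ≤ φ S) → 0ℤ ≤ ∑ φ
  ∑-nonneg {zero} p = p []
  ∑-nonneg {suc n} p = +-mono-≤ (∑-nonneg (λ S → p (outside ∷ S))) (∑-nonneg (λ S → p (inside ∷ S)))

  ∑-nonneg-zero : {φ : Subset n → ℤ} → (∀ S → 0ℤ ≤ φ S) → ∑ φ ≡ 0ℤ → ∀ S → φ S ≡ 0ℤ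
  ∑-nonneg-zero p eq [] = eq
  ∑-nonneg-zero {suc n} p eq (s ∷ S)
    with nonneg-sum-zero (∑-nonneg (λ S → p (outside ∷ S))) (∑-nonneg (λ S → p (inside ∷ S))) eq
  ∑-nonneg-zero {suc n} p eq (outside ∷ S) | e , _ = ∑-nonneg-zero (λ S → p (outside ∷ S)) e S
  ∑-nonneg-zero {suc n} p eq (inside ∷ S) | _ , e = ∑-nonneg-zero (λ S → p (inside ∷ S)) e S

  ∑-∁ : (φ : Subset n → ℤ) → ∑ (λ S → φ (∁ S)) ≡ ∑ φ
  ∑-∁ {zero} φ = refl
  ∑-∁ {suc n} φ = trans (cong₂ _+_ (∑-∁ (inn φ)) (∑-∁ (out φ))) (+-comm (∑ (inn φ)) (∑ (out φ)))

infix 8 _∙_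
_∙_ : (φ ψ : Subset n → ℤ) → ℤ
φ ∙ ψ = ∑ (λ S → φ S * ψ S)

∙-comm : (φ ψ : Subset n → ℤ) → φ ∙ ψ ≡ ψ ∙ φ
∙-comm φ ψ = ∑-cong λ S → *-comm (φ S) (ψ S)

∙-+ʳ : (φ ψ θ : Subset n → ℤ) → φ ∙ (λ S → ψ S + θ S) ≡ φ ∙ ψ + φ ∙ θ
∙-+ʳ φ ψ θ = trans (∑-cong λ S → *-distribˡ-+ (φ S) (ψ S) (θ S)) (∑-+ _ _)

∙-*ʳ : ∀ c (φ ψ : Subset n → ℤ) → φ ∙ (λ S → c * ψ S) ≡ c * φ ∙ ψ
∙-*ʳ c φ ψ = trans (∑-cong λ S → lem c (φ S) (ψ S)) (∑-* c _)
  where lem : ∀ c a b → a * (c * b) ≡ c * (a * b)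
        lem = solve-∀

norm-nonneg : (φ : Subset n → ℤ) → 0ℤ ≤ φ ∙ φ
norm-nonneg φ = ∑-nonneg λ S → square-nonneg (φ S)

norm-zero : (φ : Subset n → ℤ) → φ ∙ φ ≡ 0ℤ → ∀ S → φ S ≡ 0ℤ
norm-zero φ eq S = square-zero (φ S) (∑-nonneg-zero (λ S → square-nonneg (φ S)) eq S)

norm-combination : ∀ c (φ ψ : Subset n → ℤ) →
  (λ S → c * φ S + ψ S) ∙ (λ S → c * φ S + ψ S) ≡ c * c * φ ∙ φ + (c + c) * φ ∙ ψ + ψ ∙ ψ
norm-combination c φ ψ = begin
  ∑ (λ S → (c * φ S + ψ S) * (c * φ S + ψ S))
    ≡⟨ ∑-cong (λ S → lem c (φ S) (ψ S)) ⟩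
  ∑ (λ S → c * c * (φ S * φ S) + (c + c) * (φ S * ψ S) + ψ S * ψ S)
    ≡⟨ ∑-+ _ _ ⟩
  ∑ (λ S → c * c * (φ S * φ S) + (c + c) * (φ S * ψ S)) + ψ ∙ ψ
    ≡⟨ cong (_+ ψ ∙ ψ) (∑-+ _ _) ⟩
  ∑ (λ S → c * c * (φ S * φ S)) + ∑ (λ S → (c + c) * (φ S * ψ S)) + ψ ∙ ψ
    ≡⟨ cong₂ (λ x y → x + y + ψ ∙ ψ) (∑-* (c * c) _) (∑-* (c + c) _) ⟩
  c * c * φ ∙ φ + (c + c) * φ ∙ ψ + ψ ∙ ψ ∎
  where
  open ≡-Reasoning
  lem : ∀ c a b → (c * a + b) * (c * a + b) ≡ c * c * (a * a) + (c + c) * (a * b) + b * b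
  lem = solve-∀

-- Weights and the lattice operators

total : (Fin n → ℤ) → ℤ
total {zero} w = 0ℤ
total {suc n} w = w zero + total (w ∘ suc)

weight : (Fin n → ℤ) → Subset n → ℤ
weight w [] = 0ℤ
weight w (outside ∷ S) = weight (w ∘ suc) S
weight w (inside ∷ S) = w zero + weight (w ∘ suc) S

size : Subset n → ℤ
size = weight (λ _ → 1ℤ)

-- The raising and lowering operators of the Boolean lattice: `up φ S` sums `φ` over `S` with one
-- element removed, `down φ S` over `S` with one element added. Splitting off the first coordinate
-- turns every identity below into an induction on `n`.
up down : (Subset n → ℤ) → Subset n → ℤ
up φ [] = 0ℤ
up φ (outside ∷ S) = up (out φ) S
up φ (inside ∷ S) = up (inn φ) S + φ (outside ∷ S)
down φ [] = 0ℤ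
down φ (outside ∷ S) = down (out φ) S + φ (inside ∷ S)
down φ (inside ∷ S) = down (inn φ) S

up-cong : {φ ψ : Subset n → ℤ} → (∀ S → φ S ≡ ψ S) → ∀ S → up φ S ≡ up ψ S
up-cong eq [] = refl
up-cong eq (outside ∷ S) = up-cong (λ T → eq (outside ∷ T)) S
up-cong eq (inside ∷ S) = cong₂ _+_ (up-cong (λ T → eq (inside ∷ T)) S) (eq (outside ∷ S))

up-+ : (φ ψ : Subset n → ℤ) → ∀ S → up (λ T → φ T + ψ T) S ≡ up φ S + up ψ S
up-+ φ ψ [] = refl
up-+ φ ψ (outside ∷ S) = up-+ (out φ) (out ψ) S
up-+ φ ψ (inside ∷ S) = trans (cong (_+ (out φ S + out ψ S)) (up-+ (inn φ) (inn ψ) S))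
  (swap-middle (up (inn φ) S) (up (inn ψ) S) (out φ S) (out ψ S))

up-* : ∀ c (φ : Subset n → ℤ) S → up (λ T → c * φ T) S ≡ c * up φ S
up-* c φ [] = sym (*-zeroʳ c)
up-* c φ (outside ∷ S) = up-* c (out φ) S
up-* c φ (inside ∷ S) = trans (cong (_+ c * out φ S) (up-* c (inn φ) S))
  (sym (*-distribˡ-+ c (up (inn φ) S) (out φ S)))

down-+ : (φ ψ : Subset n → ℤ) → ∀ S → down (λ T → φ T + ψ T) S ≡ down φ S + down ψ S
down-+ φ ψ [] = refl
down-+ φ ψ (inside ∷ S) = down-+ (inn φ) (inn ψ) S
down-+ φ ψ (outside ∷ S) = trans (cong (_+ (inn φ S + inn ψ S)) (down-+ (out φ) (out ψ) S))
  (swap-middle (down (out φ) S) (down (out ψ) S) (inn φ S) (inn ψ S))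

up-down-adjoint : (φ ψ : Subset n → ℤ) → up φ ∙ ψ ≡ φ ∙ down ψ
up-down-adjoint {zero} φ ψ = ∑-cong λ { [] → trans (*-zeroˡ (ψ [])) (sym (*-zeroʳ (φ []))) }
up-down-adjoint {suc n} φ ψ = begin
  up φ ∙ ψ
    ≡⟨ ∑-split _ ⟩
  up φₒ ∙ ψₒ + (λ S → up φᵢ S + φₒ S) ∙ ψᵢ
    ≡⟨ cong (λ x → up φₒ ∙ ψₒ + x) (trans (∙-comm _ ψᵢ) (∙-+ʳ ψᵢ (up φᵢ) φₒ)) ⟩
  up φₒ ∙ ψₒ + (ψᵢ ∙ up φᵢ + ψᵢ ∙ φₒ)
    ≡⟨ cong₂ (λ x y → up φₒ ∙ ψₒ + (x + y)) (∙-comm ψᵢ (up φᵢ)) (∙-comm ψᵢ φₒ) ⟩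
  up φₒ ∙ ψₒ + (up φᵢ ∙ ψᵢ + φₒ ∙ ψᵢ)
    ≡⟨ cong₂ (λ x y → x + (y + φₒ ∙ ψᵢ)) (up-down-adjoint φₒ ψₒ) (up-down-adjoint φᵢ ψᵢ) ⟩
  φₒ ∙ down ψₒ + (φᵢ ∙ down ψᵢ + φₒ ∙ ψᵢ)
    ≡⟨ lem (φₒ ∙ down ψₒ) (φᵢ ∙ down ψᵢ) (φₒ ∙ ψᵢ) ⟩
  φₒ ∙ down ψₒ + φₒ ∙ ψᵢ + φᵢ ∙ down ψᵢ
    ≡⟨ cong (_+ φᵢ ∙ down ψᵢ) (sym (∙-+ʳ φₒ (down ψₒ) ψᵢ)) ⟩
  φₒ ∙ out (down ψ) + φᵢ ∙ inn (down ψ)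
    ≡⟨ ∑-split _ ⟨
  φ ∙ down ψ ∎
  where
  open ≡-Reasoning
  φₒ = out φ
  φᵢ = inn φ
  ψₒ = out ψ
  ψᵢ = inn ψ
  lem : ∀ a b c → a + (b + c) ≡ a + c + b
  lem = solve-∀

-- Exchanging one element for another arises equally in both orders. What remains is the diagonal:
-- adding and then removing the same element can be done in n - |S| ways, removing and then adding
-- it in |S| ways.
commutator : (φ : Subset n → ℤ) → ∀ S →
  down (up φ) S ≡ up (down φ) S + (+ n - + 2 * size S) * φ S
commutator φ [] = refl
commutator {suc n} φ (outside ∷ S) = begin
  down (up (out φ)) S + (up (inn φ) S + φ (outside ∷ S))
    ≡⟨ cong (_+ (up (inn φ) S + out φ S)) (commutator (out φ) S) ⟩
  up (down (out φ)) S + (+ n - + 2 * size S) * out φ S + (up (inn φ) S + out φ S)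
    ≡⟨ lem (up (down (out φ)) S) (up (inn φ) S) (out φ S) (+ n) (size S) ⟩
  up (down (out φ)) S + up (inn φ) S + (1ℤ + + n - + 2 * size S) * out φ S
    ≡⟨ cong (_+ (1ℤ + + n - + 2 * size S) * out φ S) (sym (up-+ (down (out φ)) (inn φ) S)) ⟩
  up (out (down φ)) S + (1ℤ + + n - + 2 * size S) * out φ S ∎
  where
  open ≡-Reasoning
  lem : ∀ a b c n s → a + (n - + 2 * s) * c + (b + c) ≡ a + b + (1ℤ + n - + 2 * s) * c
  lem = solve-∀
commutator {suc n} φ (inside ∷ S) = begin
  down (inn (up φ)) S
    ≡⟨ down-+ (up (inn φ)) (out φ) S ⟩
  down (up (inn φ)) S + down (out φ) S
    ≡⟨ cong (_+ down (out φ) S) (commutator (inn φ) S) ⟩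
  up (down (inn φ)) S + (+ n - + 2 * size S) * inn φ S + down (out φ) S
    ≡⟨ lem (up (down (inn φ)) S) (down (out φ) S) (inn φ S) (+ n) (size S) ⟩
  up (down (inn φ)) S + (down (out φ) S + inn φ S) + (1ℤ + + n - + 2 * (1ℤ + size S)) * inn φ S ∎
  where
  open ≡-Reasoning
  lem : ∀ a b c n s → a + (n - + 2 * s) * c + b ≡ a + (b + c) + (1ℤ + n - + 2 * (1ℤ + s)) * c
  lem = solve-∀

-- Levels and contraction of up

up-const : ∀ c (S : Subset n) → up (λ _ → c) S ≡ size S * c
up-const c [] = refl
up-const c (outside ∷ S) = up-const c S
up-const c (inside ∷ S) = trans (cong (_+ c) (up-const c S)) (lem (size S) c)
  where lem : ∀ s c → s * c + c ≡ (1ℤ + s) * c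
        lem = solve-∀

down-const : ∀ c (S : Subset n) → down (λ _ → c) S ≡ (+ n - size S) * c
down-const c [] = refl
down-const {suc n} c (outside ∷ S) = trans (cong (_+ c) (down-const c S)) (lem (+ n) (size S) c)
  where lem : ∀ n s c → (n - s) * c + c ≡ (1ℤ + n - s) * c
        lem = solve-∀
down-const {suc n} c (inside ∷ S) = trans (down-const c S) (lem (+ n) (size S) c)
  where lem : ∀ n s c → (n - s) * c ≡ (1ℤ + n - (1ℤ + s)) * c
        lem = solve-∀

-- Each vertex of `S` survives all but one of the removals.
up-weight : ∀ w (S : Subset n) → up (weight w) S ≡ (size S - 1ℤ) * weight w S
up-weight w [] = refl
up-weight w (outside ∷ S) = up-weight (w ∘ suc) S
up-weight w (inside ∷ S) = begin
  up (λ T → w zero + weight w′ T) S + weight w′ S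
    ≡⟨ cong (_+ weight w′ S) (up-+ (λ _ → w zero) (weight w′) S) ⟩
  up (λ _ → w zero) S + up (weight w′) S + weight w′ S
    ≡⟨ cong₂ (λ x y → x + y + weight w′ S) (up-const (w zero) S) (up-weight w′ S) ⟩
  size S * w zero + (size S - 1ℤ) * weight w′ S + weight w′ S
    ≡⟨ lem (size S) (w zero) (weight w′ S) ⟩
  (1ℤ + size S - 1ℤ) * (w zero + weight w′ S) ∎
  where
  open ≡-Reasoning
  w′ = w ∘ suc
  lem : ∀ s a b → s * a + (s - 1ℤ) * b + b ≡ (1ℤ + s - 1ℤ) * (a + b)
  lem = solve-∀

-- The added vertices run over the complement of `S`, so together they contribute
-- `total w - weight w S`.
down-weight : ∀ w (S : Subset n) → down (weight w) S ≡ (+ n - size S - 1ℤ) * weight w S + total w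
down-weight w [] = refl
down-weight {suc n} w (outside ∷ S) =
  trans (cong (_+ (w zero + weight (w ∘ suc) S)) (down-weight (w ∘ suc) S))
        (lem (+ n) (size S) (weight (w ∘ suc) S) (total (w ∘ suc)) (w zero))
  where lem : ∀ n s b t a → (n - s - 1ℤ) * b + t + (a + b) ≡ (1ℤ + n - s - 1ℤ) * b + (a + t)
        lem = solve-∀
down-weight {suc n} w (inside ∷ S) = begin
  down (λ T → w zero + weight w′ T) S
    ≡⟨ down-+ (λ _ → w zero) (weight w′) S ⟩
  down (λ _ → w zero) S + down (weight w′) S
    ≡⟨ cong₂ _+_ (down-const (w zero) S) (down-weight w′ S) ⟩
  (+ n - size S) * w zero + ((+ n - size S - 1ℤ) * weight w′ S + total w′)
    ≡⟨ lem (+ n) (size S) (weight w′ S) (total w′) (w zero) ⟩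
  (1ℤ + + n - (1ℤ + size S) - 1ℤ) * (w zero + weight w′ S) + (w zero + total w′) ∎
  where
  open ≡-Reasoning
  w′ = w ∘ suc
  lem : ∀ n s b t a → (n - s) * a + ((n - s - 1ℤ) * b + t) ≡ (1ℤ + n - (1ℤ + s) - 1ℤ) * (a + b) + (a + t)
  lem = solve-∀

size≡∣∣ : ∀ (S : Subset n) → size S ≡ + ∣ S ∣
size≡∣∣ [] = refl
size≡∣∣ (outside ∷ S) = size≡∣∣ S
size≡∣∣ (inside ∷ S) = cong (λ x → 1ℤ + x) (size≡∣∣ S)

-- Support on the sets of size `k`, phrased as an eigenvalue equation: being linear, it passes
-- through `up` and `down` by ring identities. An integer `k` lets `inn` lower the level without a
-- case split at zero.
record Level (k : ℤ) (φ : Subset n → ℤ) : Set where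
  field
    scale : ∀ S → size S * φ S ≡ k * φ S
open Level

Level-out : ∀ {k} {φ : Subset (suc n) → ℤ} → Level k φ → Level k (out φ)
scale (Level-out lv) S = scale lv (outside ∷ S)

Level-inn : ∀ {k} {φ : Subset (suc n) → ℤ} → Level k φ → Level (k - 1ℤ) (inn φ)
scale (Level-inn {k = k} {φ} lv) S = begin
  size S * x ≡⟨ lem₁ (size S) x ⟩
  (1ℤ + size S) * x - x ≡⟨ cong (_- x) (scale lv (inside ∷ S)) ⟩
  k * x - x ≡⟨ lem₂ k x ⟩
  (k - 1ℤ) * x ∎
  where
  open ≡-Reasoning
  x = φ (inside ∷ S)
  lem₁ : ∀ s x → s * x ≡ (1ℤ + s) * x - x
  lem₁ = solve-∀
  lem₂ : ∀ k x → k * x - x ≡ (k - 1ℤ) * x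
  lem₂ = solve-∀

up-Level : ∀ {k} {φ : Subset n → ℤ} → Level k φ → Level (1ℤ + k) (up φ)
scale (up-Level {k = k} lv) [] = sym (*-zeroʳ (1ℤ + k))
scale (up-Level lv) (outside ∷ S) = scale (up-Level (Level-out lv)) S
scale (up-Level {k = k} {φ} lv) (inside ∷ S) = begin
  (1ℤ + size S) * (x + y) ≡⟨ lem₁ (size S) x y ⟩
  size S * x + size S * y + (x + y) ≡⟨ cong₂ (λ a b → a + b + (x + y)) (scale (up-Level (Level-inn lv)) S) (scale lv (outside ∷ S)) ⟩
  (1ℤ + (k - 1ℤ)) * x + k * y + (x + y) ≡⟨ lem₂ k x y ⟩
  (1ℤ + k) * (x + y) ∎
  where
  open ≡-Reasoning
  x = up (inn φ) S
  y = out φ S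
  lem₁ : ∀ s x y → (1ℤ + s) * (x + y) ≡ s * x + s * y + (x + y)
  lem₁ = solve-∀
  lem₂ : ∀ k x y → (1ℤ + (k - 1ℤ)) * x + k * y + (x + y) ≡ (1ℤ + k) * (x + y)
  lem₂ = solve-∀

down-Level : ∀ {k} {φ : Subset n → ℤ} → Level k φ → Level (k - 1ℤ) (down φ)
scale (down-Level {k = k} lv) [] = sym (*-zeroʳ (k - 1ℤ))
scale (down-Level {k = k} {φ} lv) (outside ∷ S) = begin
  size S * (x + y) ≡⟨ *-distribˡ-+ (size S) x y ⟩
  size S * x + size S * y ≡⟨ cong₂ _+_ (scale (down-Level (Level-out lv)) S) (scale (Level-inn lv) S) ⟩
  (k - 1ℤ) * x + (k - 1ℤ) * y ≡⟨ *-distribˡ-+ (k - 1ℤ) x y ⟨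
  (k - 1ℤ) * (x + y) ∎
  where
  open ≡-Reasoning
  x = down (out φ) S
  y = inn φ S
scale (down-Level {k = k} {φ} lv) (inside ∷ S) = begin
  (1ℤ + size S) * x ≡⟨ lem₁ (size S) x ⟩
  x + size S * x ≡⟨ cong (λ y → x + y) (scale (down-Level (Level-inn lv)) S) ⟩
  x + (k - 1ℤ - 1ℤ) * x ≡⟨ lem₂ k x ⟩
  (k - 1ℤ) * x ∎
  where
  open ≡-Reasoning
  x = down (inn φ) S
  lem₁ : ∀ s x → (1ℤ + s) * x ≡ x + s * x
  lem₁ = solve-∀
  lem₂ : ∀ k x → x + (k - 1ℤ - 1ℤ) * x ≡ (k - 1ℤ) * x
  lem₂ = solve-∀

Level-subst : ∀ {k l} {φ : Subset n → ℤ} → k ≡ l → Level k φ → Level l φ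
Level-subst refl lv = lv

Orthogonal : (Subset n → ℤ) → Set
Orthogonal φ = ∑ φ ≡ 0ℤ × (∀ w → weight w ∙ φ ≡ 0ℤ)

∑≡1∙ : (φ : Subset n → ℤ) → ∑ φ ≡ (λ _ → 1ℤ) ∙ φ
∑≡1∙ φ = ∑-cong λ S → sym (*-identityˡ (φ S))

module _ {k} {φ : Subset n → ℤ} (lv : Level k φ) (orth : Orthogonal φ) where
  open ≡-Reasoning

  -- The adjoint sends affine test functions to affine ones, because the size is constant on a
  -- level. The same argument serves `up`.
  down-Orthogonal : Orthogonal (down φ)
  down-Orthogonal = ∑down , λ w → begin
    weight w ∙ down φ ≡⟨ up-down-adjoint (weight w) φ ⟨
    up (weight w) ∙ φ ≡⟨ ∑-cong (λ S → cong (_* φ S) (up-weight w S)) ⟩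
    ∑ (λ S → (size S - 1ℤ) * weight w S * φ S)
      ≡⟨ ∑-cong (λ S → trans (lem₁ (size S) (weight w S) (φ S)) (cong (λ x → weight w S * x - weight w S * φ S) (scale lv S))) ⟩
    ∑ (λ S → weight w S * (k * φ S) - weight w S * φ S)
      ≡⟨ ∑-cong (λ S → lem₂ k (weight w S) (φ S)) ⟩
    ∑ (λ S → (k - 1ℤ) * (weight w S * φ S)) ≡⟨ ∑-* (k - 1ℤ) _ ⟩
    (k - 1ℤ) * weight w ∙ φ ≡⟨ cong ((k - 1ℤ) *_) (proj₂ orth w) ⟩
    (k - 1ℤ) * 0ℤ ≡⟨ *-zeroʳ (k - 1ℤ) ⟩
    0ℤ ∎
    where
    lem₁ : ∀ s w x → (s - 1ℤ) * w * x ≡ w * (s * x) - w * x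
    lem₁ = solve-∀
    lem₂ : ∀ k w x → w * (k * x) - w * x ≡ (k - 1ℤ) * (w * x)
    lem₂ = solve-∀
    ∑down : ∑ (down φ) ≡ 0ℤ
    ∑down = begin
      ∑ (down φ) ≡⟨ ∑≡1∙ (down φ) ⟩
      (λ _ → 1ℤ) ∙ down φ ≡⟨ up-down-adjoint (λ _ → 1ℤ) φ ⟨
      up (λ _ → 1ℤ) ∙ φ ≡⟨ ∑-cong (λ S → cong (_* φ S) (trans (up-const 1ℤ S) (*-identityʳ (size S)))) ⟩
      size ∙ φ ≡⟨ proj₂ orth (λ _ → 1ℤ) ⟩
      0ℤ ∎

  up-Orthogonal : Orthogonal (up φ)
  up-Orthogonal = ∑up , λ w → begin
    weight w ∙ up φ ≡⟨ ∙-comm (weight w) (up φ) ⟩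
    up φ ∙ weight w ≡⟨ up-down-adjoint φ (weight w) ⟩
    φ ∙ down (weight w) ≡⟨ ∑-cong (λ S → cong (φ S *_) (down-weight w S)) ⟩
    ∑ (λ S → φ S * ((+ n - size S - 1ℤ) * weight w S + total w))
      ≡⟨ ∑-cong (λ S → trans (lem₁ (+ n) (size S) (weight w S) (total w) (φ S))
           (cong (λ x → (+ n - 1ℤ) * (weight w S * φ S) - weight w S * x + total w * φ S) (scale lv S))) ⟩
    ∑ (λ S → (+ n - 1ℤ) * (weight w S * φ S) - weight w S * (k * φ S) + total w * φ S)
      ≡⟨ ∑-cong (λ S → lem₂ (+ n) k (weight w S) (total w) (φ S)) ⟩
    ∑ (λ S → (+ n - 1ℤ - k) * (weight w S * φ S) + total w * φ S) ≡⟨ ∑-+ _ _ ⟩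
    ∑ (λ S → (+ n - 1ℤ - k) * (weight w S * φ S)) + ∑ (λ S → total w * φ S)
      ≡⟨ cong₂ _+_ (∑-* (+ n - 1ℤ - k) _) (∑-* (total w) φ) ⟩
    (+ n - 1ℤ - k) * weight w ∙ φ + total w * ∑ φ
      ≡⟨ cong₂ (λ x y → (+ n - 1ℤ - k) * x + total w * y) (proj₂ orth w) (proj₁ orth) ⟩
    (+ n - 1ℤ - k) * 0ℤ + total w * 0ℤ ≡⟨ cong₂ _+_ (*-zeroʳ (+ n - 1ℤ - k)) (*-zeroʳ (total w)) ⟩
    0ℤ ∎
    where
    lem₁ : ∀ n s w t x → x * ((n - s - 1ℤ) * w + t) ≡ (n - 1ℤ) * (w * x) - w * (s * x) + t * x
    lem₁ = solve-∀
    lem₂ : ∀ n k w t x → (n - 1ℤ) * (w * x) - w * (k * x) + t * x ≡ (n - 1ℤ - k) * (w * x) + t * x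
    lem₂ = solve-∀
    lem₃ : ∀ n s x → x * (n - s) ≡ n * x - s * x
    lem₃ = solve-∀
    ∑up : ∑ (up φ) ≡ 0ℤ
    ∑up = begin
      ∑ (up φ) ≡⟨ ∑-cong (λ S → sym (*-identityʳ (up φ S))) ⟩
      up φ ∙ (λ _ → 1ℤ) ≡⟨ up-down-adjoint φ (λ _ → 1ℤ) ⟩
      φ ∙ down (λ _ → 1ℤ) ≡⟨ ∑-cong (λ S → trans (cong (φ S *_) (trans (down-const 1ℤ S) (*-identityʳ (+ n - size S))))
           (trans (lem₃ (+ n) (size S) (φ S)) (trans (cong (λ x → + n * φ S - x) (scale lv S)) (lem₄ (+ n) k (φ S))))) ⟩
      ∑ (λ S → (+ n - k) * φ S) ≡⟨ ∑-* (+ n - k) φ ⟩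
      (+ n - k) * ∑ φ ≡⟨ cong ((+ n - k) *_) (proj₁ orth) ⟩
      (+ n - k) * 0ℤ ≡⟨ *-zeroʳ (+ n - k) ⟩
      0ℤ ∎
      where
      lem₄ : ∀ n k x → n * x - k * x ≡ (n - k) * x
      lem₄ = solve-∀

norm-up : ∀ {k} {φ : Subset n → ℤ} → Level k φ →
  up φ ∙ up φ ≡ down φ ∙ down φ + (+ n - + 2 * k) * φ ∙ φ
norm-up {n} {k} {φ} lv = begin
  up φ ∙ up φ ≡⟨ up-down-adjoint φ (up φ) ⟩
  φ ∙ down (up φ) ≡⟨ ∑-cong (λ S → trans (cong (φ S *_) (commutator φ S))
    (trans (lem₁ (φ S) (up (down φ) S) (+ n) (size S)) (trans (cong (λ x → φ S * up (down φ) S + φ S * (+ n * φ S - + 2 * x)) (scale lv S))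
      (lem₂ (φ S) (up (down φ) S) (+ n) k)))) ⟩
  ∑ (λ S → φ S * up (down φ) S + (+ n - + 2 * k) * (φ S * φ S)) ≡⟨ ∑-+ _ _ ⟩
  φ ∙ up (down φ) + ∑ (λ S → (+ n - + 2 * k) * (φ S * φ S))
    ≡⟨ cong₂ _+_ (trans (∙-comm φ (up (down φ))) (up-down-adjoint (down φ) φ)) (∑-* (+ n - + 2 * k) _) ⟩
  down φ ∙ down φ + (+ n - + 2 * k) * φ ∙ φ ∎
  where
  open ≡-Reasoning
  lem₁ : ∀ x y n s → x * (y + (n - + 2 * s) * x) ≡ x * y + x * (n * x - + 2 * (s * x))
  lem₁ = solve-∀
  lem₂ : ∀ x y n k → x * y + x * (n * x - + 2 * (k * x)) ≡ x * y + (n - + 2 * k) * (x * x)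
  lem₂ = solve-∀

-- No set has size -1; this disposes of the `inside` half when a function at level zero is split.
Level-negative : ∀ {φ : Subset n → ℤ} → Level (- 1ℤ) φ → ∀ S → φ S ≡ 0ℤ
Level-negative {φ = φ} lv S with i*j≡0⇒i≡0∨j≡0 (+ suc ∣ S ∣) {φ S} eq
  where
  open ≡-Reasoning
  lem₁ : ∀ s x → (1ℤ + s) * x ≡ s * x + x
  lem₁ = solve-∀
  lem₂ : ∀ x → - 1ℤ * x + x ≡ 0ℤ
  lem₂ = solve-∀
  eq : + suc ∣ S ∣ * φ S ≡ 0ℤ
  eq = begin
    (1ℤ + + ∣ S ∣) * φ S ≡⟨ cong (λ s → (1ℤ + s) * φ S) (size≡∣∣ S) ⟨
    (1ℤ + size S) * φ S ≡⟨ lem₁ (size S) (φ S) ⟩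
    size S * φ S + φ S ≡⟨ cong (_+ φ S) (scale lv S) ⟩
    - 1ℤ * φ S + φ S ≡⟨ lem₂ (φ S) ⟩
    0ℤ ∎
... | inj₂ p = p

Level₀-zero : ∀ {φ : Subset n → ℤ} → Level 0ℤ φ → ∑ φ ≡ 0ℤ → ∀ S → φ S ≡ 0ℤ
Level₀-zero {φ = φ} lv eq [] = trans (sym (∑-empty φ)) eq
Level₀-zero {φ = φ} lv eq (inside ∷ S) = Level-negative (Level-inn lv) S
Level₀-zero {φ = φ} lv eq (outside ∷ S) = Level₀-zero (Level-out lv) (begin
  ∑ (out φ) ≡⟨ +-identityʳ _ ⟨
  ∑ (out φ) + 0ℤ ≡⟨ cong (λ y → ∑ (out φ) + y) (∑-0 (Level-negative (Level-inn lv))) ⟨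
  ∑ (out φ) + ∑ (inn φ) ≡⟨ ∑-split φ ⟨
  ∑ φ ≡⟨ eq ⟩
  0ℤ ∎) S
  where open ≡-Reasoning

-- A function on singletons is determined by its pairings with the weights concentrated at one
-- vertex. This is the base of the contraction bounds.
Level₁-zero : ∀ {φ : Subset n → ℤ} → Level 1ℤ φ → Orthogonal φ → ∀ S → φ S ≡ 0ℤ
Level₁-zero {φ = φ} lv _ [] = trans (sym (*-identityˡ (φ []))) (sym (scale lv []))
Level₁-zero {suc n} {φ} lv (∑≡0 , orth) = λ
  { (outside ∷ S) → Level₁-zero (Level-out lv) (∑out , wout) S
  ; (inside ∷ S) → inn≡0 S }
  where
  open ≡-Reasoning
  at-zero : Fin (suc n) → ℤ
  at-zero zero = 1ℤ
  at-zero (suc i) = 0ℤ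
  weight-0 : ∀ {n} (S : Subset n) → weight (λ _ → 0ℤ) S ≡ 0ℤ
  weight-0 [] = refl
  weight-0 (outside ∷ S) = weight-0 S
  weight-0 (inside ∷ S) = trans (+-identityˡ _) (weight-0 S)
  inn≡0 : ∀ S → inn φ S ≡ 0ℤ
  inn≡0 = Level₀-zero (Level-inn lv) (begin
    ∑ (inn φ) ≡⟨ +-identityˡ _ ⟨
    0ℤ + ∑ (inn φ) ≡⟨ cong₂ _+_ (∑-0 (λ S → cong (_* out φ S) (weight-0 S)))
        (∑-cong (λ S → trans (cong (λ x → (1ℤ + x) * inn φ S) (weight-0 S)) (*-identityˡ (inn φ S)))) ⟨
    _ ≡⟨ ∑-split (λ S → weight at-zero S * φ S) ⟨
    weight at-zero ∙ φ ≡⟨ orth at-zero ⟩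
    0ℤ ∎)
  ∑out : ∑ (out φ) ≡ 0ℤ
  ∑out = begin
    ∑ (out φ) ≡⟨ +-identityʳ _ ⟨
    ∑ (out φ) + 0ℤ ≡⟨ cong (λ y → ∑ (out φ) + y) (∑-0 inn≡0) ⟨
    ∑ (out φ) + ∑ (inn φ) ≡⟨ ∑-split φ ⟨
    ∑ φ ≡⟨ ∑≡0 ⟩
    0ℤ ∎
  extend : (Fin n → ℤ) → Fin (suc n) → ℤ
  extend w zero = 0ℤ
  extend w (suc i) = w i
  wout : ∀ w → weight w ∙ out φ ≡ 0ℤ
  wout w = begin
    weight w ∙ out φ ≡⟨ +-identityʳ _ ⟨
    weight w ∙ out φ + 0ℤ
      ≡⟨ cong (λ y → weight w ∙ out φ + y) (∑-0 (λ S → trans (cong ((0ℤ + weight w S) *_) (inn≡0 S)) (*-zeroʳ (0ℤ + weight w S)))) ⟨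
    _ ≡⟨ ∑-split (λ S → weight (extend w) S * φ S) ⟨
    weight (extend w) ∙ φ ≡⟨ orth (extend w) ⟩
    0ℤ ∎

norm-of-zero : {φ : Subset n → ℤ} → (∀ S → φ S ≡ 0ℤ) → φ ∙ φ ≡ 0ℤ
norm-of-zero {φ = φ} eq = ∑-0 λ S → cong (λ x → x * φ S) (eq S)

-- Cauchy–Schwarz without square roots: expand ‖θ − c φ‖² ≥ 0.
norm-adjoint-bound : ∀ c .{{_ : Positive c}} {P} (φ θ : Subset n → ℤ) →
  φ ∙ θ ≡ P → θ ∙ θ ≤ c * P → P ≤ c * φ ∙ φ
norm-adjoint-bound c {P} φ θ eq θθ≤ = *-cancelˡ-≤-pos P (c * φ ∙ φ) c (0≤i-j⇒j≤i (begin
  0ℤ ≤⟨ norm-nonneg (λ S → - c * φ S + θ S) ⟩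
  (λ S → - c * φ S + θ S) ∙ (λ S → - c * φ S + θ S) ≡⟨ norm-combination (- c) φ θ ⟩
  - c * - c * φ ∙ φ + (- c + - c) * φ ∙ θ + θ ∙ θ ≤⟨ +-monoʳ-≤ (- c * - c * φ ∙ φ + (- c + - c) * φ ∙ θ) θθ≤ ⟩
  - c * - c * φ ∙ φ + (- c + - c) * φ ∙ θ + c * P ≡⟨ cong (λ x → - c * - c * φ ∙ φ + (- c + - c) * x + c * P) eq ⟩
  - c * - c * φ ∙ φ + (- c + - c) * P + c * P ≡⟨ lem c (φ ∙ φ) P ⟩
  c * (c * φ ∙ φ) - c * P ∎))
  where
  open ≤-Reasoning
  lem : ∀ c a p → - c * - c * a + (- c + - c) * p + c * p ≡ c * (c * a) - c * p
  lem = solve-∀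

-- The bound (s − 1)(n − s − 2) is the eigenvalue of down ∘ up at level s = k + 1 on harmonic functions of degree two.
up-contraction : ∀ k q {φ : Subset n → ℤ} → n ≡ k ℕ.+ 3 ℕ.+ q →
  Level (+ suc k) φ → Orthogonal φ → up φ ∙ up φ ≤ + k * + q * φ ∙ φ
-- Adjoint operators have the same norm: the constant is that of `up` one level lower, applied to
-- `down φ`.
down-contraction : ∀ k q {φ : Subset n → ℤ} → n ≡ k ℕ.+ 4 ℕ.+ q →
  Level (+ suc (suc k)) φ → Orthogonal φ → down φ ∙ down φ ≤ + k * + suc q * φ ∙ φ

up-contraction zero q {φ} n≡ lv orth = ≤-reflexive (norm-of-zero λ S →
  trans (up-cong {ψ = λ _ → 0ℤ} (Level₁-zero lv orth) S) (trans (up-const 0ℤ S) (*-zeroʳ (size S))))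
-- At level s the recursion closes because (s - 2)(n - s - 1) + (n - 2s) = (s - 1)(n - s - 2).
up-contraction {n} (suc k) q {φ} n≡ lv orth = begin
  up φ ∙ up φ ≡⟨ norm-up lv ⟩
  down φ ∙ down φ + (+ n - + 2 * + suc (suc k)) * φ ∙ φ
    ≤⟨ +-monoˡ-≤ ((+ n - + 2 * + suc (suc k)) * φ ∙ φ) (down-contraction k q (trans n≡ (cong (ℕ._+ q) (sym (ℕₚ.+-suc k 3)))) lv orth) ⟩
  + k * + suc q * φ ∙ φ + (+ n - + 2 * + suc (suc k)) * φ ∙ φ
    ≡⟨ cong (λ m → + k * + suc q * φ ∙ φ + (m - + 2 * + suc (suc k)) * φ ∙ φ) (cong +_ n≡) ⟩
  + k * (1ℤ + + q) * φ ∙ φ + ((1ℤ + (+ k + + 3 + + q)) - + 2 * (1ℤ + (1ℤ + + k))) * φ ∙ φ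
    ≡⟨ lem (+ k) (+ q) (φ ∙ φ) ⟩
  + suc k * + q * φ ∙ φ ∎
  where
  open ≤-Reasoning
  lem : ∀ k q a → k * (1ℤ + q) * a + ((1ℤ + (k + + 3 + q)) - + 2 * (1ℤ + (1ℤ + k))) * a ≡ (1ℤ + k) * q * a
  lem = solve-∀

down-contraction zero q n≡ lv orth = ≤-reflexive
  (norm-of-zero (Level₁-zero (down-Level lv) (down-Orthogonal lv orth)))
down-contraction (suc k) q {φ} n≡ lv orth =
  norm-adjoint-bound (+ suc k * + suc q) φ (up (down φ))
    (trans (∙-comm φ (up (down φ))) (up-down-adjoint (down φ) φ))
    (up-contraction (suc k) (suc q) (trans n≡ (lem k q)) (down-Level lv) (down-Orthogonal lv orth))
  where
  lem : ∀ k q → suc k ℕ.+ 4 ℕ.+ q ≡ suc k ℕ.+ 3 ℕ.+ suc q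
  lem k q = trans (cong (ℕ._+ q) (ℕₚ.+-suc (suc k) 3)) (sym (ℕₚ.+-suc (suc k ℕ.+ 3) q))

-- Iterating `up`

up^ : ℕ → (Subset n → ℤ) → Subset n → ℤ
up^ zero φ = φ
up^ (suc m) φ = up^ m (up φ)

up^-cong : ∀ m {φ ψ : Subset n → ℤ} → (∀ S → φ S ≡ ψ S) → ∀ S → up^ m φ S ≡ up^ m ψ S
up^-cong zero eq = eq
up^-cong (suc m) eq = up^-cong m (up-cong eq)

up^-combination : ∀ m c (φ ψ : Subset n → ℤ) S →
  up^ m (λ T → c * φ T + ψ T) S ≡ c * up^ m φ S + up^ m ψ S
up^-combination zero c φ ψ S = refl
up^-combination (suc m) c φ ψ S = trans
  (up^-cong m (λ T → trans (up-+ (λ U → c * φ U) ψ T) (cong (_+ up ψ T) (up-* c φ T))) S)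
  (up^-combination m c (up φ) (up ψ) S)

up^-Level : ∀ m {k} {φ : Subset n → ℤ} → Level k φ → Level (+ m + k) (up^ m φ)
up^-Level zero {k} lv = Level-subst (sym (+-identityˡ k)) lv
up^-Level (suc m) {k} lv = Level-subst (lem (+ m) k) (up^-Level m (up-Level lv))
  where lem : ∀ m k → m + (1ℤ + k) ≡ 1ℤ + m + k
        lem = solve-∀

up^-Orthogonal : ∀ m {k} {φ : Subset n → ℤ} → Level k φ → Orthogonal φ → Orthogonal (up^ m φ)
up^-Orthogonal zero lv orth = orth
up^-Orthogonal (suc m) lv orth = up^-Orthogonal m (up-Level lv) (up-Orthogonal lv orth)

-- `up φ E` reads `φ` only at subsets of `E`.
up-vanish : ∀ {T : Subset n} {φ : Subset n → ℤ} → (∀ E → E ⊆ T → φ E ≡ 0ℤ) → ∀ E → E ⊆ T → up φ E ≡ 0ℤ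
up-vanish van [] sub = refl
up-vanish {T = t ∷ T} van (outside ∷ E) sub =
  up-vanish (λ F F⊆ → van (outside ∷ F) (out⊆ F⊆)) E (drop-∷-⊆ sub)
up-vanish {T = outside ∷ T} van (inside ∷ E) sub with () ← sub here
up-vanish {T = inside ∷ T} van (inside ∷ E) sub = cong₂ _+_
  (up-vanish (λ F F⊆ → van (inside ∷ F) (s⊆s F⊆)) E (drop-∷-⊆ sub))
  (van (outside ∷ E) (out⊆ (drop-∷-⊆ sub)))

up^-vanish : ∀ m {T : Subset n} {φ : Subset n → ℤ} → (∀ E → E ⊆ T → φ E ≡ 0ℤ) → ∀ E → E ⊆ T → up^ m φ E ≡ 0ℤ
up^-vanish zero van = van
up^-vanish (suc m) van = up^-vanish m (up-vanish van)

rising : ℕ → ℕ → ℤ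
rising k zero = 1ℤ
rising k (suc m) = + k * rising (suc k) m

-- Peeling off the last factor; compared with the defining first factor, this gives the ratios
-- between the eigenvalues `Λ₀`, `Λ₁` and `Λ₂`.
rising-last : ∀ k m → rising k (suc m) ≡ (+ k + + m) * rising k m
rising-last k zero = cong (λ x → x * 1ℤ) (sym (+-identityʳ (+ k)))
rising-last k (suc m) = trans (cong (λ x → + k * x) (rising-last (suc k) m)) (lem (+ k) (+ m) (rising (suc k) m))
  where lem : ∀ k m x → k * ((1ℤ + k + m) * x) ≡ (k + (1ℤ + m)) * (k * x)
        lem = solve-∀

rising-pos : ∀ k m → Positive (rising (suc k) m)
rising-pos k zero = _
rising-pos k (suc m) = positive (subst (_< + suc k * rising (suc (suc k)) m) (*-zeroʳ (+ suc k))
  (*-monoˡ-<-pos (+ suc k) (positive⁻¹ _ {{rising-pos (suc k) m}})))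

rising-nonneg : ∀ k m → NonNegative (rising k m)
rising-nonneg k zero = _
rising-nonneg k (suc m) = nonNegative (subst (_≤ + k * rising (suc k) m) (*-zeroʳ (+ k))
  (*-monoˡ-≤-nonNeg (+ k) (nonNegative⁻¹ _ {{rising-nonneg (suc k) m}})))

-- While the level s climbs, the factor s - 1 runs upwards from `k` and n - s - 2 runs downwards to
-- `j`; both products are rising factorials.
up^-contraction : ∀ m k j {φ : Subset n → ℤ} → n ≡ k ℕ.+ j ℕ.+ m ℕ.+ 2 →
  Level (+ suc k) φ → Orthogonal φ → up^ m φ ∙ up^ m φ ≤ rising k m * (rising j m * φ ∙ φ)
up^-contraction zero k j {φ} n≡ lv orth = ≤-reflexive (sym (trans (*-identityˡ _) (*-identityˡ _)))
up^-contraction (suc m) k j {φ} n≡ lv orth = begin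
  up^ m (up φ) ∙ up^ m (up φ)
    ≤⟨ up^-contraction m (suc k) j (trans n≡ (lem₁ k j m)) (up-Level lv) (up-Orthogonal lv orth) ⟩
  rising (suc k) m * (rising j m * up φ ∙ up φ)
    ≤⟨ *-monoˡ-≤-nonNeg (rising (suc k) m) {{rising-nonneg (suc k) m}}
        (*-monoˡ-≤-nonNeg (rising j m) {{rising-nonneg j m}} (up-contraction k (j ℕ.+ m) (trans n≡ (lem₂ k j m)) lv orth)) ⟩
  rising (suc k) m * (rising j m * (+ k * (+ j + + m) * φ ∙ φ))
    ≡⟨ lem₃ (+ k) (+ j + + m) (rising (suc k) m) (rising j m) (φ ∙ φ) ⟩
  + k * rising (suc k) m * ((+ j + + m) * rising j m * φ ∙ φ)
    ≡⟨ cong (λ x → + k * rising (suc k) m * (x * φ ∙ φ)) (rising-last j m) ⟨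
  rising k (suc m) * (rising j (suc m) * φ ∙ φ) ∎
  where
  open ≤-Reasoning
  lem₁ : ∀ k j m → k ℕ.+ j ℕ.+ suc m ℕ.+ 2 ≡ suc k ℕ.+ j ℕ.+ m ℕ.+ 2
  lem₁ k j m = cong (ℕ._+ 2) (ℕₚ.+-suc (k ℕ.+ j) m)
  lem₂ : ∀ k j m → k ℕ.+ j ℕ.+ suc m ℕ.+ 2 ≡ k ℕ.+ 3 ℕ.+ (j ℕ.+ m)
  lem₂ = NS.solve-∀
    where import Data.Nat.Tactic.RingSolver as NS
  lem₃ : ∀ k q x y a → x * (y * (k * q * a)) ≡ k * x * (q * y * a)
  lem₃ = solve-∀

-- Affine functions on one level, and complements

χ : ℤ → Subset n → ℤ
χ k S = if does (size S ≟ k) then 1ℤ else 0ℤ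

χ≡1 : ∀ {k} (S : Subset n) → size S ≡ k → χ k S ≡ 1ℤ
χ≡1 {k = k} S eq with size S ≟ k
... | yes _ = refl
... | no ¬p = contradiction eq ¬p

χ≡0 : ∀ {k} (S : Subset n) → ¬ (size S ≡ k) → χ k S ≡ 0ℤ
χ≡0 {k = k} S ¬eq with size S ≟ k
... | yes p = contradiction p ¬eq
... | no _ = refl

χ-inside : ∀ k (S : Subset n) → χ k (inside ∷ S) ≡ χ (k - 1ℤ) S
χ-inside k S with 1ℤ + size S ≟ k
... | yes p = sym (χ≡1 S (trans (lem (size S)) (cong (_- 1ℤ) p)))
  where lem : ∀ s → s ≡ 1ℤ + s - 1ℤ
        lem = solve-∀
... | no ¬p = sym (χ≡0 S λ eq → ¬p (trans (cong (λ x → 1ℤ + x) eq) (lem k)))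
  where lem : ∀ k → 1ℤ + (k - 1ℤ) ≡ k
        lem = solve-∀

χ-Level : ∀ k → Level {n} k (χ k)
Level.scale (χ-Level k) S with size S ≟ k
... | yes p = cong (_* 1ℤ) p
... | no _ = trans (*-zeroʳ (size S)) (sym (*-zeroʳ k))

-- A set of size k + 1 has k + 1 subsets of size k, and each of its vertices lies in k of them.
up-affine : ∀ k b w (S : Subset n) → up (λ T → χ k T * (b + weight w T)) S
  ≡ χ (1ℤ + k) S * ((1ℤ + k) * b + k * weight w S)
up-affine k b w [] with 0ℤ ≟ 1ℤ + k
... | no _ = refl
-- Here k = -1: the cutoff does not vanish at the empty set, but both coefficients contribute zero.
... | yes p = sym (trans (cong (λ x → 1ℤ * (x * b + k * 0ℤ)) (sym p)) (lem b k))
  where lem : ∀ b k → 1ℤ * (0ℤ * b + k * 0ℤ) ≡ 0ℤ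
        lem = solve-∀
up-affine k b w (outside ∷ S) = up-affine k b (w ∘ suc) S
up-affine {suc n} k b w (inside ∷ S) = begin
  up (λ T → χ k (inside ∷ T) * (b + (w zero + weight w′ T))) S + χ k S * (b + weight w′ S)
    ≡⟨ cong (_+ χ k S * (b + weight w′ S)) (up-cong (λ T → cong₂ _*_ (χ-inside k T) (sym (+-assoc b (w zero) (weight w′ T)))) S) ⟩
  up (λ T → χ (k - 1ℤ) T * (b + w zero + weight w′ T)) S + χ k S * (b + weight w′ S)
    ≡⟨ cong (_+ χ k S * (b + weight w′ S)) (up-affine (k - 1ℤ) (b + w zero) w′ S) ⟩
  χ (1ℤ + (k - 1ℤ)) S * ((1ℤ + (k - 1ℤ)) * (b + w zero) + (k - 1ℤ) * weight w′ S) + χ k S * (b + weight w′ S)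
    ≡⟨ cong (λ i → χ i S * ((1ℤ + (k - 1ℤ)) * (b + w zero) + (k - 1ℤ) * weight w′ S) + χ k S * (b + weight w′ S)) (lem₁ k) ⟩
  χ k S * ((1ℤ + (k - 1ℤ)) * (b + w zero) + (k - 1ℤ) * weight w′ S) + χ k S * (b + weight w′ S)
    ≡⟨ lem₂ (χ k S) k b (w zero) (weight w′ S) ⟩
  χ k S * ((1ℤ + k) * b + k * (w zero + weight w′ S))
    ≡⟨ cong (λ x → x * ((1ℤ + k) * b + k * (w zero + weight w′ S)))
        (trans (χ-inside (1ℤ + k) S) (cong (λ i → χ i S) (lem₃ k))) ⟨
  χ (1ℤ + k) (inside ∷ S) * ((1ℤ + k) * b + k * (w zero + weight w′ S)) ∎
  where
  open ≡-Reasoning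
  w′ : Fin n → ℤ
  w′ = w ∘ suc
  lem₁ : ∀ k → 1ℤ + (k - 1ℤ) ≡ k
  lem₁ = solve-∀
  lem₂ : ∀ x k b a y → x * ((1ℤ + (k - 1ℤ)) * (b + a) + (k - 1ℤ) * y) + x * (b + y) ≡ x * ((1ℤ + k) * b + k * (a + y))
  lem₂ = solve-∀
  lem₃ : ∀ k → 1ℤ + k - 1ℤ ≡ k
  lem₃ = solve-∀

weight-* : ∀ c w (S : Subset n) → weight (λ i → c * w i) S ≡ c * weight w S
weight-* c w [] = sym (*-zeroʳ c)
weight-* c w (outside ∷ S) = weight-* c (w ∘ suc) S
weight-* c w (inside ∷ S) = trans (cong (λ x → c * w zero + x) (weight-* c (w ∘ suc) S))
  (sym (*-distribˡ-+ c (w zero) (weight (w ∘ suc) S)))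

-- The constant and the weight scale by different rising factorials; followed by complementation,
-- these become the disjointness eigenvalues of degree zero and one.
up^-affine : ∀ m k b w (S : Subset n) → up^ m (λ T → χ (+ k) T * (b + weight w T)) S
  ≡ χ (+ (m ℕ.+ k)) S * (rising (suc k) m * b + rising k m * weight w S)
up^-affine zero k b w S = cong (λ x → χ (+ k) S * x) (sym (cong₂ _+_ (*-identityˡ b) (*-identityˡ (weight w S))))
up^-affine (suc m) k b w S = begin
  up^ m (up (λ T → χ (+ k) T * (b + weight w T))) S
    ≡⟨ up^-cong m (λ T → trans (up-affine (+ k) b w T)
        (cong (λ x → χ (+ suc k) T * (+ suc k * b + x)) (sym (weight-* (+ k) w T)))) S ⟩
  up^ m (λ T → χ (+ suc k) T * (+ suc k * b + weight (λ i → + k * w i) T)) S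
    ≡⟨ up^-affine m (suc k) (+ suc k * b) (λ i → + k * w i) S ⟩
  χ (+ (m ℕ.+ suc k)) S * (rising (suc (suc k)) m * (+ suc k * b) + rising (suc k) m * weight (λ i → + k * w i) S)
    ≡⟨ cong₂ (λ x y → χ (+ x) S * (rising (suc (suc k)) m * (+ suc k * b) + rising (suc k) m * y)) (ℕₚ.+-suc m k) (weight-* (+ k) w S) ⟩
  χ (+ suc (m ℕ.+ k)) S * (rising (suc (suc k)) m * (+ suc k * b) + rising (suc k) m * (+ k * weight w S))
    ≡⟨ cong (λ x → χ (+ suc (m ℕ.+ k)) S * x) (lem (+ suc k) (+ k) (rising (suc (suc k)) m) (rising (suc k) m) b (weight w S)) ⟩
  χ (+ suc (m ℕ.+ k)) S * (+ suc k * rising (suc (suc k)) m * b + + k * rising (suc k) m * weight w S) ∎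
  where
  open ≡-Reasoning
  lem : ∀ k₁ k r₂ r₁ b x → r₂ * (k₁ * b) + r₁ * (k * x) ≡ k₁ * r₂ * b + k * r₁ * x
  lem = solve-∀

weight-∁ : ∀ w (S : Subset n) → weight w (∁ S) ≡ total w - weight w S
weight-∁ w [] = refl
weight-∁ w (outside ∷ S) = trans (cong (λ x → w zero + x) (weight-∁ (w ∘ suc) S)) (lem (w zero) (total (w ∘ suc)) (weight (w ∘ suc) S))
  where lem : ∀ a t x → a + (t - x) ≡ a + t - x
        lem = solve-∀
weight-∁ w (inside ∷ S) = trans (weight-∁ (w ∘ suc) S) (lem (w zero) (total (w ∘ suc)) (weight (w ∘ suc) S))
  where lem : ∀ a t x → t - x ≡ a + t - (a + x)
        lem = solve-∀

total-1 : ∀ n → total {n} (λ _ → 1ℤ) ≡ + n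
total-1 zero = refl
total-1 (suc n) = cong (λ x → 1ℤ + x) (total-1 n)

size-∁ : ∀ (S : Subset n) → size (∁ S) ≡ + n - size S
size-∁ {n} S = trans (weight-∁ (λ _ → 1ℤ) S) (cong (_- size S) (total-1 n))

χ-∁ : ∀ {k l} (S : Subset n) → k + l ≡ + n → χ k (∁ S) ≡ χ l S
χ-∁ {n} {k} {l} S k+l≡n with size S ≟ l
... | yes p = χ≡1 (∁ S) (trans (size-∁ S) (trans (cong₂ _-_ (sym k+l≡n) p) (lem k l)))
  where lem : ∀ k l → k + l - l ≡ k
        lem = solve-∀
... | no ¬p = χ≡0 (∁ S) λ eq → ¬p (begin
  size S ≡⟨ lem (+ n) (size S) ⟩
  + n - (+ n - size S) ≡⟨ cong₂ _-_ (sym k+l≡n) (trans (sym (size-∁ S)) eq) ⟩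
  k + l - k ≡⟨ lem₂ k l ⟩
  l ∎)
  where
  open ≡-Reasoning
  lem : ∀ n s → s ≡ n - (n - s)
  lem = solve-∀
  lem₂ : ∀ k l → k + l - k ≡ l
  lem₂ = solve-∀

-- Sums over the r-subsets

-- The binomial coefficient with an integer lower index, zero below 0, so that Pascal's rule has no
-- boundary case.
β : ℕ → ℤ → ℤ
β n k = ∑ {n} (χ k)

β-suc : ∀ n k → β (suc n) k ≡ β n k + β n (k - 1ℤ)
β-suc n k = trans (∑-split (χ k)) (cong (λ x → β n k + x) (∑-cong (χ-inside k)))

χ-negative : ∀ k (S : Subset n) → χ -[1+ k ] S ≡ 0ℤ
χ-negative k S = χ≡0 S λ eq → lem (trans (sym (size≡∣∣ S)) eq)
  where lem : ∀ {i} → ¬ (+ i ≡ -[1+ k ])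
        lem ()

β≡C : ∀ n k → β n (+ k) ≡ + (n C k)
β≡C zero zero = ∑-empty (χ 0ℤ)
β≡C zero (suc k) = trans (∑-empty (χ (+ suc k))) (cong +_ (sym (k>n⇒nCk≡0 {0} {suc k} (ℕ.s≤s ℕ.z≤n))))
β≡C (suc n) zero = trans (β-suc n 0ℤ) (cong₂ _+_ (β≡C n zero) (∑-0 (χ-negative 0)))
β≡C (suc n) (suc k) = trans (β-suc n (+ suc k))
  (trans (cong₂ _+_ (β≡C n (suc k)) (β≡C n k))
         (cong +_ (trans (ℕₚ.+-comm (n C suc k) (n C k)) (nCk+nC[k+1]≡[n+1]C[k+1] n k))))

C-positive : ∀ n k → k ℕ.≤ n → 0 ℕ.< n C k
C-positive n zero _ = ℕ.s≤s ℕ.z≤n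
C-positive (suc n) (suc k) (ℕ.s≤s k≤n) = subst (0 ℕ.<_) (nCk+nC[k+1]≡[n+1]C[k+1] n k)
  (ℕₚ.<-≤-trans (C-positive n k k≤n) (ℕₚ.m≤m+n (n C k) (n C suc k)))

∑χ-weight-split : ∀ k (w : Fin (suc n) → ℤ) → χ k ∙ weight w
  ≡ χ k ∙ weight (w ∘ suc) + (w zero * β n (k - 1ℤ) + χ (k - 1ℤ) ∙ weight (w ∘ suc))
∑χ-weight-split {n} k w = begin
  χ k ∙ weight w ≡⟨ ∑-split (λ S → χ k S * weight w S) ⟩
  χ k ∙ weight (w ∘ suc) + ∑ (λ S → χ k (inside ∷ S) * (w zero + weight (w ∘ suc) S))
    ≡⟨ cong (λ x → χ k ∙ weight (w ∘ suc) + x) (∑-cong λ S → trans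
        (cong (_* (w zero + weight (w ∘ suc) S)) (χ-inside k S))
        (lem (χ (k - 1ℤ) S) (w zero) (weight (w ∘ suc) S))) ⟩
  χ k ∙ weight (w ∘ suc) + ∑ (λ S → w zero * χ (k - 1ℤ) S + χ (k - 1ℤ) S * weight (w ∘ suc) S)
    ≡⟨ cong (λ x → χ k ∙ weight (w ∘ suc) + x) (trans (∑-+ _ _) (cong (_+ χ (k - 1ℤ) ∙ weight (w ∘ suc)) (∑-* (w zero) _))) ⟩
  χ k ∙ weight (w ∘ suc) + (w zero * β n (k - 1ℤ) + χ (k - 1ℤ) ∙ weight (w ∘ suc)) ∎
  where
  open ≡-Reasoning
  lem : ∀ x a b → x * (a + b) ≡ a * x + x * b
  lem = solve-∀

χ∙weight : ∀ k (w : Fin (suc n) → ℤ) → χ k ∙ weight w ≡ total w * β n (k - 1ℤ)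
χ∙weight {zero} k w = begin
  χ k ∙ weight w ≡⟨ ∑χ-weight-split k w ⟩
  χ k ∙ weight (w ∘ suc) + (w zero * β 0 (k - 1ℤ) + χ (k - 1ℤ) ∙ weight (w ∘ suc))
    ≡⟨ cong₂ (λ x y → x + (w zero * β 0 (k - 1ℤ) + y)) (vanish k) (vanish (k - 1ℤ)) ⟩
  0ℤ + (w zero * β 0 (k - 1ℤ) + 0ℤ) ≡⟨ lem (w zero) (β 0 (k - 1ℤ)) ⟩
  total w * β 0 (k - 1ℤ) ∎
  where
  open ≡-Reasoning
  vanish : ∀ k → χ k ∙ weight (w ∘ suc) ≡ 0ℤ
  vanish k = ∑-0 λ { [] → *-zeroʳ (χ k []) }
  lem : ∀ a b → 0ℤ + (a * b + 0ℤ) ≡ (a + 0ℤ) * b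
  lem = solve-∀
χ∙weight {suc n} k w = begin
  χ k ∙ weight w ≡⟨ ∑χ-weight-split k w ⟩
  χ k ∙ weight (w ∘ suc) + (w zero * β (suc n) (k - 1ℤ) + χ (k - 1ℤ) ∙ weight (w ∘ suc))
    ≡⟨ cong₂ (λ x y → x + (w zero * β (suc n) (k - 1ℤ) + y)) (χ∙weight k (w ∘ suc)) (χ∙weight (k - 1ℤ) (w ∘ suc)) ⟩
  t * β n (k - 1ℤ) + (w zero * β (suc n) (k - 1ℤ) + t * β n (k - 1ℤ - 1ℤ))
    ≡⟨ lem t (w zero) (β n (k - 1ℤ)) (β n (k - 1ℤ - 1ℤ)) (β (suc n) (k - 1ℤ)) ⟩
  w zero * β (suc n) (k - 1ℤ) + t * (β n (k - 1ℤ) + β n (k - 1ℤ - 1ℤ))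
    ≡⟨ cong (λ x → w zero * β (suc n) (k - 1ℤ) + t * x) (β-suc n (k - 1ℤ)) ⟨
  w zero * β (suc n) (k - 1ℤ) + t * β (suc n) (k - 1ℤ)
    ≡⟨ *-distribʳ-+ (β (suc n) (k - 1ℤ)) (w zero) t ⟨
  total w * β (suc n) (k - 1ℤ) ∎
  where
  open ≡-Reasoning
  t : ℤ
  t = total (w ∘ suc)
  lem : ∀ t a x y z → t * x + (a * z + t * y) ≡ a * z + t * (x + y)
  lem = solve-∀

dot : (u w : Fin n → ℤ) → ℤ
dot u w = total (λ i → u i * w i)

χ∙weight²-split : ∀ k (u w : Fin (suc n) → ℤ) → let u′ = u ∘ suc; w′ = w ∘ suc in
  χ k ∙ (λ S → weight u S * weight w S)
  ≡ χ k ∙ (λ S → weight u′ S * weight w′ S)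
    + (u zero * w zero * β n (k - 1ℤ) + (u zero * χ (k - 1ℤ) ∙ weight w′ + w zero * χ (k - 1ℤ) ∙ weight u′)
      + χ (k - 1ℤ) ∙ (λ S → weight u′ S * weight w′ S))
χ∙weight²-split {n} k u w = trans (∑-split (λ S → χ k S * (weight u S * weight w S))) (cong (λ x → χ k ∙ (λ S → weight u′ S * weight w′ S) + x) (begin
  ∑ (λ S → χ k (inside ∷ S) * ((u zero + weight u′ S) * (w zero + weight w′ S)))
    ≡⟨ ∑-cong (λ S → trans (cong (_* ((u zero + weight u′ S) * (w zero + weight w′ S))) (χ-inside k S))
         (lem (χ l S) (u zero) (w zero) (weight u′ S) (weight w′ S))) ⟩
  ∑ (λ S → u zero * w zero * χ l S + (u zero * (χ l S * weight w′ S) + w zero * (χ l S * weight u′ S)) + χ l S * (weight u′ S * weight w′ S))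
    ≡⟨ trans (∑-+ _ _) (cong (_+ χ l ∙ (λ S → weight u′ S * weight w′ S)) (trans (∑-+ _ _)
        (cong₂ _+_ (∑-* (u zero * w zero) (χ l)) (trans (∑-+ _ _) (cong₂ _+_ (∑-* (u zero) _) (∑-* (w zero) _)))))) ⟩
  u zero * w zero * β n l + (u zero * χ l ∙ weight w′ + w zero * χ l ∙ weight u′)
      + χ l ∙ (λ S → weight u′ S * weight w′ S) ∎))
  where
  open ≡-Reasoning
  l : ℤ
  l = k - 1ℤ
  u′ w′ : Fin n → ℤ
  u′ = u ∘ suc
  w′ = w ∘ suc
  lem : ∀ x a b c d → x * ((a + c) * (b + d)) ≡ a * b * x + (a * (x * d) + b * (x * c)) + x * (c * d)
  lem = solve-∀

-- Expand over ordered pairs of vertices: an equal pair needs one vertex in the set, a distinct pair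
-- needs two. With a single vertex there are no distinct pairs and the second coefficient is zero,
-- so the truncated `n ∸ 1` is harmless.
χ∙weight² : ∀ k (u w : Fin (suc n) → ℤ) → χ k ∙ (λ S → weight u S * weight w S)
  ≡ dot u w * β n (k - 1ℤ) + (total u * total w - dot u w) * β (n ∸ 1) (k - 1ℤ - 1ℤ)
χ∙weight² {zero} k u w = begin
  χ k ∙ (λ S → weight u S * weight w S) ≡⟨ χ∙weight²-split k u w ⟩
  _ ≡⟨ cong₂ (λ x y → x + (a * b * β 0 l + (a * χ l ∙ weight (w ∘ suc) + b * χ l ∙ weight (u ∘ suc)) + y)) (vanish k) (vanish l) ⟩
  0ℤ + (a * b * β 0 l + (a * χ l ∙ weight (w ∘ suc) + b * χ l ∙ weight (u ∘ suc)) + 0ℤ)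
     ≡⟨ cong₂ (λ x y → 0ℤ + (a * b * β 0 l + (a * x + b * y) + 0ℤ)) (vanish₁ (w ∘ suc)) (vanish₁ (u ∘ suc)) ⟩
  0ℤ + (a * b * β 0 l + (a * 0ℤ + b * 0ℤ) + 0ℤ) ≡⟨ lem a b (β 0 l) (β 0 (l - 1ℤ)) ⟩
  (a * b + 0ℤ) * β 0 l + ((a + 0ℤ) * (b + 0ℤ) - (a * b + 0ℤ)) * β 0 (l - 1ℤ) ∎
  where
  open ≡-Reasoning
  a b l : ℤ
  a = u zero
  b = w zero
  l = k - 1ℤ
  vanish : ∀ k → χ k ∙ (λ S → weight (u ∘ suc) S * weight (w ∘ suc) S) ≡ 0ℤ
  vanish k = ∑-0 λ { [] → *-zeroʳ (χ k []) }
  vanish₁ : ∀ v → χ l ∙ weight v ≡ 0ℤ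
  vanish₁ v = ∑-0 λ { [] → *-zeroʳ (χ l []) }
  lem : ∀ a b x y → 0ℤ + (a * b * x + (a * 0ℤ + b * 0ℤ) + 0ℤ) ≡ (a * b + 0ℤ) * x + ((a + 0ℤ) * (b + 0ℤ) - (a * b + 0ℤ)) * y
  lem = solve-∀
χ∙weight² {suc n} k u w = begin
  χ k ∙ (λ S → weight u S * weight w S) ≡⟨ χ∙weight²-split k u w ⟩
  _ ≡⟨ cong₂ (λ x y → x + (a * b * β (suc n) l + (a * χ l ∙ weight (w ∘ suc) + b * χ l ∙ weight (u ∘ suc)) + y))
        (χ∙weight² k (u ∘ suc) (w ∘ suc)) (χ∙weight² l (u ∘ suc) (w ∘ suc)) ⟩
  _ ≡⟨ cong₂ (λ x y → p * β n l + q * B₁ + (a * b * β (suc n) l + (a * x + b * y) + (p * β n (l - 1ℤ) + q * B₂)))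
        (χ∙weight l (w ∘ suc)) (χ∙weight l (u ∘ suc)) ⟩
  p * β n l + q * B₁ + (a * b * β (suc n) l + (a * (tw * β n (l - 1ℤ)) + b * (tu * β n (l - 1ℤ))) + (p * β n (l - 1ℤ) + q * B₂))
    ≡⟨ lem₁ p q a b tu tw (β n l) (β n (l - 1ℤ)) (β (suc n) l) B₁ B₂ ⟩
  p * (β n l + β n (l - 1ℤ)) + (q * (B₁ + B₂) + (a * b * β (suc n) l + (a * tw + b * tu) * β n (l - 1ℤ)))
    ≡⟨ cong₂ (λ x y → p * x + (y + (a * b * β (suc n) l + (a * tw + b * tu) * β n (l - 1ℤ)))) (sym (β-suc n l)) (pascal u w) ⟩
  p * β (suc n) l + (q * β n (l - 1ℤ) + (a * b * β (suc n) l + (a * tw + b * tu) * β n (l - 1ℤ)))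
    ≡⟨ lem₂ p a b tu tw (β n (l - 1ℤ)) (β (suc n) l) ⟩
  (a * b + p) * β (suc n) l + ((a + tu) * (b + tw) - (a * b + p)) * β n (l - 1ℤ) ∎
  where
  open ≡-Reasoning
  a b l p q tu tw B₁ B₂ : ℤ
  a = u zero
  b = w zero
  l = k - 1ℤ
  tu = total (u ∘ suc)
  tw = total (w ∘ suc)
  p = dot (u ∘ suc) (w ∘ suc)
  q = tu * tw - p
  B₁ = β (n ∸ 1) (l - 1ℤ)
  B₂ = β (n ∸ 1) (l - 1ℤ - 1ℤ)
  pascal : ∀ {n} (u w : Fin (suc (suc n)) → ℤ) →
    (total (u ∘ suc) * total (w ∘ suc) - dot (u ∘ suc) (w ∘ suc)) * (β (n ∸ 1) (l - 1ℤ) + β (n ∸ 1) (l - 1ℤ - 1ℤ))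
    ≡ (total (u ∘ suc) * total (w ∘ suc) - dot (u ∘ suc) (w ∘ suc)) * β n (l - 1ℤ)
  -- One vertex is left, so the coefficient is zero; Pascal's rule would be false for the truncated
  -- index.
  pascal {zero} u w = lem (u (suc zero)) (w (suc zero)) _ _
    where lem : ∀ a b x y → ((a + 0ℤ) * (b + 0ℤ) - (a * b + 0ℤ)) * x ≡ ((a + 0ℤ) * (b + 0ℤ) - (a * b + 0ℤ)) * y
          lem = solve-∀
  pascal {suc n} u w = cong (λ x → (total (u ∘ suc) * total (w ∘ suc) - dot (u ∘ suc) (w ∘ suc)) * x) (sym (β-suc n (l - 1ℤ)))
  lem₁ : ∀ p q a b tu tw x y z B₁ B₂ →
    p * x + q * B₁ + (a * b * z + (a * (tw * y) + b * (tu * y)) + (p * y + q * B₂))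
    ≡ p * (x + y) + (q * (B₁ + B₂) + (a * b * z + (a * tw + b * tu) * y))
  lem₁ = solve-∀
  lem₂ : ∀ p a b tu tw y z →
    p * z + ((tu * tw - p) * y + (a * b * z + (a * tw + b * tu) * y))
    ≡ (a * b + p) * z + ((a + tu) * (b + tw) - (a * b + p)) * y
  lem₂ = solve-∀

-- Double counting of incidences: `χ∙weight` for the constant weight one.
k*β : ∀ n k → k * β (suc n) k ≡ + suc n * β n (k - 1ℤ)
k*β n k = begin
  k * ∑ {suc n} (χ k) ≡⟨ ∑-* k (χ k) ⟨
  ∑ (λ S → k * χ k S) ≡⟨ ∑-cong (λ S → trans (sym (Level.scale (χ-Level k) S)) (*-comm (size S) (χ k S))) ⟩
  χ k ∙ size {suc n} ≡⟨ χ∙weight k (λ _ → 1ℤ) ⟩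
  total {suc n} (λ _ → 1ℤ) * β n (k - 1ℤ) ≡⟨ cong (λ x → x * β n (k - 1ℤ)) (total-1 (suc n)) ⟩
  + suc n * β n (k - 1ℤ) ∎
  where open ≡-Reasoning

-- The spectral inequality

*-positive : ∀ i j .{{_ : Positive i}} .{{_ : Positive j}} → Positive (i * j)
*-positive +[1+ i ] +[1+ j ] = _

+-positive : ∀ i j .{{_ : Positive i}} .{{_ : Positive j}} → Positive (i + j)
+-positive +[1+ i ] +[1+ j ] = _

+-pos-nonneg : ∀ i j .{{_ : Positive (+ i)}} → Positive (+ i + + j)
+-pos-nonneg (suc i) j = _

nonneg-cancel : ∀ c {x} .{{_ : Positive c}} → 0ℤ ≤ c * x → 0ℤ ≤ x
nonneg-cancel c {x} p = *-cancelˡ-≤-pos 0ℤ x c (subst (_≤ c * x) (sym (*-zeroʳ c)) p)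

dot-affine : ∀ (u d : Fin n → ℤ) c e x →
  dot u (λ i → c * (e - x * d i)) ≡ c * (e * total u - x * dot u d)
dot-affine {zero} u d c e x = lem c e x
  where lem : ∀ c e x → 0ℤ ≡ c * (e * 0ℤ - x * 0ℤ)
        lem = solve-∀
dot-affine {suc n} u d c e x = trans
  (cong (λ y → u zero * (c * (e - x * d zero)) + y) (dot-affine (u ∘ suc) (d ∘ suc) c e x))
  (lem (u zero) (d zero) (total (u ∘ suc)) (dot (u ∘ suc) (d ∘ suc)) c e x)
  where lem : ∀ a b t s c e x → a * (c * (e - x * b)) + c * (e * t - x * s) ≡ c * (e * (a + t) - x * (a * b + s))
        lem = solve-∀

total-cong : {u w : Fin n → ℤ} → (∀ i → u i ≡ w i) → total u ≡ total w
total-cong {zero} eq = refl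
total-cong {suc n} eq = cong₂ _+_ (eq zero) (total-cong (eq ∘ suc))

∁-involutive : (S : Subset n) → ∁ (∁ S) ≡ S
∁-involutive [] = refl
∁-involutive (outside ∷ S) = cong (outside ∷_) (∁-involutive S)
∁-involutive (inside ∷ S) = cong (inside ∷_) (∁-involutive S)

∑-adjoint-∁ : (φ ψ : Subset n → ℤ) → ∑ (λ S → φ S * ψ (∁ S)) ≡ ∑ (λ S → φ (∁ S) * ψ S)
∑-adjoint-∁ φ ψ = trans (sym (∑-∁ (λ S → φ S * ψ (∁ S))))
  (∑-cong λ S → cong (λ T → φ (∁ S) * ψ T) (∁-involutive S))

Level-χ : ∀ {k} {φ : Subset n → ℤ} → Level k φ → ∀ S → φ S * χ k S ≡ φ S
Level-χ {k = k} {φ} lv S with size S ≟ k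
... | yes _ = *-identityʳ (φ S)
... | no size≢k = trans (*-zeroʳ (φ S)) (sym (zero-off (φ S) (Level.scale lv S)))
  where
  zero-off : ∀ x → size S * x ≡ k * x → x ≡ 0ℤ
  zero-off (+ 0) _ = refl
  zero-off +[1+ i ] eq = contradiction (*-cancelʳ-≡ (size S) k +[1+ i ] eq) size≢k
  zero-off -[1+ i ] eq = contradiction (*-cancelʳ-≡ (size S) k -[1+ i ] eq) size≢k

affine : ℤ → ℤ → (Fin n → ℤ) → Subset n → ℤ
affine k b w S = χ k S * (b + weight w S)

∙affine : ∀ {k} {φ : Subset n → ℤ} → Level k φ → ∀ b w →
  φ ∙ affine k b w ≡ b * ∑ φ + weight w ∙ φ
∙affine {k = k} {φ} lv b w = begin
  ∑ (λ S → φ S * (χ k S * (b + weight w S)))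
    ≡⟨ ∑-cong (λ S → trans (sym (*-assoc (φ S) (χ k S) (b + weight w S)))
         (trans (cong (_* (b + weight w S)) (Level-χ lv S)) (lem (φ S) b (weight w S)))) ⟩
  ∑ (λ S → b * φ S + weight w S * φ S) ≡⟨ ∑-+ _ _ ⟩
  ∑ (λ S → b * φ S) + weight w ∙ φ ≡⟨ cong (_+ weight w ∙ φ) (∑-* b φ) ⟩
  b * ∑ φ + weight w ∙ φ ∎
  where
  open ≡-Reasoning
  lem : ∀ x b y → x * (b + y) ≡ b * x + y * x
  lem = solve-∀

affine-Level : ∀ k b (w : Fin n → ℤ) → Level k (affine k b w)
Level.scale (affine-Level k b w) S = begin
  size S * (χ k S * y) ≡⟨ *-assoc (size S) (χ k S) y ⟨
  size S * χ k S * y ≡⟨ cong (_* y) (Level.scale (χ-Level k) S) ⟩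
  k * χ k S * y ≡⟨ *-assoc k (χ k S) y ⟩
  k * (χ k S * y) ∎
  where
  open ≡-Reasoning
  y : ℤ
  y = b + weight w S

∑-affine : ∀ k b (w : Fin (suc n) → ℤ) → ∑ (affine k b w) ≡ b * β (suc n) k + total w * β n (k - 1ℤ)
∑-affine {n} k b w = begin
  ∑ (λ S → χ k S * (b + weight w S)) ≡⟨ ∑-cong (λ S → lem (χ k S) b (weight w S)) ⟩
  ∑ (λ S → b * χ k S + χ k S * weight w S) ≡⟨ ∑-+ _ _ ⟩
  ∑ (λ S → b * χ k S) + χ k ∙ weight w ≡⟨ cong₂ _+_ (∑-* b (χ k)) (χ∙weight k w) ⟩
  b * β (suc n) k + total w * β n (k - 1ℤ) ∎
  where
  open ≡-Reasoning
  lem : ∀ x b y → x * (b + y) ≡ b * x + x * y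
  lem = solve-∀

weight∙affine : ∀ k b (u w : Fin (suc n) → ℤ) → weight u ∙ affine k b w
  ≡ b * (total u * β n (k - 1ℤ)) + (dot u w * β n (k - 1ℤ) + (total u * total w - dot u w) * β (n ∸ 1) (k - 1ℤ - 1ℤ))
weight∙affine {n} k b u w = begin
  ∑ (λ S → weight u S * (χ k S * (b + weight w S))) ≡⟨ ∑-cong (λ S → lem (χ k S) b (weight u S) (weight w S)) ⟩
  ∑ (λ S → b * (χ k S * weight u S) + χ k S * (weight u S * weight w S)) ≡⟨ ∑-+ _ _ ⟩
  ∑ (λ S → b * (χ k S * weight u S)) + χ k ∙ (λ S → weight u S * weight w S)
    ≡⟨ cong₂ _+_ (trans (∑-* b _) (cong (λ x → b * x) (χ∙weight k u))) (χ∙weight² k u w) ⟩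
  _ ∎
  where
  open ≡-Reasoning
  lem : ∀ x b u w → u * (x * (b + w)) ≡ b * (x * u) + x * (u * w)
  lem = solve-∀

-- The remainder `g` and the two estimates of its norm

order : ℕ → ℕ → ℕ
order k m = suc (suc (k ℕ.+ k ℕ.+ m))

-- `f-cross` is the form in which the intersection property enters: `up^ m f (∁ S)` is m! times the
-- number of edges disjoint from `S`.
module Spectral (k m : ℕ)
  (f : Subset (order k m) → ℤ) (d : Fin (order k m) → ℤ)
  (f-level : Level (+ suc k) f) (f-idem : ∀ S → f S * f S ≡ f S)
  (f-degree : ∀ w → weight w ∙ f ≡ dot w d)
  (f-cross : ∀ S → f S * up^ m f (∁ S) ≡ 0ℤ) where

  -- The paper's parameters are n = ν, r = ρ = k + 1 and n − 2r = m; moreover q = n − r.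
  ν ρ q c₀ c₁ c₂ h X : ℤ
  ν = + order k m
  ρ = + suc k
  q = + suc k + + m
  c₀ = β (order k m) ρ
  c₁ = β (suc (k ℕ.+ k ℕ.+ m)) (ρ - 1ℤ)
  c₂ = β (k ℕ.+ k ℕ.+ m) (ρ - 1ℤ - 1ℤ)
  h = ∑ f
  X = dot d d

  ρc₀≡νc₁ : ρ * c₀ ≡ ν * c₁
  ρc₀≡νc₁ = k*β _ ρ

  kc₁≡[ν-1]c₂ : + k * c₁ ≡ (ν - 1ℤ) * c₂
  kc₁≡[ν-1]c₂ = k*β _ (+ k)

  total-d : total d ≡ ρ * h
  total-d = begin
    total d ≡⟨ total-cong (λ i → *-identityˡ (d i)) ⟨
    dot (λ _ → 1ℤ) d ≡⟨ f-degree (λ _ → 1ℤ) ⟨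
    ∑ (λ S → size S * f S) ≡⟨ ∑-cong (Level.scale f-level) ⟩
    ∑ (λ S → ρ * f S) ≡⟨ ∑-* ρ f ⟩
    ρ * h ∎
    where open ≡-Reasoning

  -- These coefficients make a f + affine ρ b w orthogonal to all affine functions.
  a b T Z : ℤ
  a = ν * q * c₁
  b = - (ρ * q * h)
  w : Fin (order k m) → ℤ
  w i = (ν - 1ℤ) * (ρ * h - ν * d i)
  T = (ν - 1ℤ) * (ρ * h * (ρ * h) - ν * X)
  Z = a * h + b * h + T

  θ g : Subset (order k m) → ℤ
  θ = affine ρ b w
  g S = a * f S + θ S

  dot-w : ∀ u → dot u w ≡ (ν - 1ℤ) * (ρ * h * total u - ν * dot u d)
  dot-w u = dot-affine u d (ν - 1ℤ) (ρ * h) ν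

  total-w : total w ≡ 0ℤ
  total-w = begin
    total w ≡⟨ total-cong (λ i → *-identityˡ (w i)) ⟨
    dot (λ _ → 1ℤ) w ≡⟨ dot-w (λ _ → 1ℤ) ⟩
    (ν - 1ℤ) * (ρ * h * total {order k m} (λ _ → 1ℤ) - ν * dot (λ _ → 1ℤ) d)
      ≡⟨ cong₂ (λ x y → (ν - 1ℤ) * (ρ * h * x - ν * y)) (total-1 (order k m))
           (trans (total-cong (λ i → *-identityˡ (d i))) total-d) ⟩
    (ν - 1ℤ) * (ρ * h * ν - ν * (ρ * h)) ≡⟨ lem ν (ρ * h) ⟩
    0ℤ ∎
    where
    open ≡-Reasoning
    lem : ∀ ν x → (ν - 1ℤ) * (x * ν - ν * x) ≡ 0ℤ
    lem = solve-∀

  dot-wd : weight w ∙ f ≡ T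
  dot-wd = begin
    weight w ∙ f ≡⟨ f-degree w ⟩
    dot w d ≡⟨ total-cong (λ i → *-comm (w i) (d i)) ⟩
    dot d w ≡⟨ dot-w d ⟩
    (ν - 1ℤ) * (ρ * h * total d - ν * X) ≡⟨ cong (λ x → (ν - 1ℤ) * (ρ * h * x - ν * X)) total-d ⟩
    T ∎
    where open ≡-Reasoning

  g-level : Level ρ g
  Level.scale g-level S = begin
    size S * (a * f S + θ S) ≡⟨ lem₁ (size S) a (f S) (θ S) ⟩
    a * (size S * f S) + size S * θ S
      ≡⟨ cong₂ (λ x y → a * x + y) (Level.scale f-level S) (Level.scale (affine-Level ρ b w) S) ⟩
    a * (ρ * f S) + ρ * θ S ≡⟨ lem₁ ρ a (f S) (θ S) ⟨
    ρ * (a * f S + θ S) ∎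
    where
    open ≡-Reasoning
    lem₁ : ∀ s a x y → s * (a * x + y) ≡ a * (s * x) + s * y
    lem₁ = solve-∀

  g-orthogonal : Orthogonal g
  g-orthogonal = (begin
    ∑ (λ S → a * f S + θ S) ≡⟨ ∑-+ _ _ ⟩
    ∑ (λ S → a * f S) + ∑ θ ≡⟨ cong₂ _+_ (∑-* a f) (∑-affine ρ b w) ⟩
    a * h + (b * c₀ + total w * c₁) ≡⟨ cong (λ x → a * h + (b * c₀ + x * c₁)) total-w ⟩
    a * h + (b * c₀ + 0ℤ * c₁) ≡⟨ lem₁ ν q c₁ ρ h c₀ ⟩
    q * h * (ν * c₁ - ρ * c₀) ≡⟨ cong (λ x → q * h * (ν * c₁ - x)) ρc₀≡νc₁ ⟩
    q * h * (ν * c₁ - ν * c₁) ≡⟨ lem₂ (q * h) (ν * c₁) ⟩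
    0ℤ ∎) , λ u → begin
    weight u ∙ g ≡⟨ ∙-+ʳ (weight u) (λ S → a * f S) θ ⟩
    weight u ∙ (λ S → a * f S) + weight u ∙ θ
      ≡⟨ cong₂ _+_ (trans (∙-*ʳ a (weight u) f) (cong (λ x → a * x) (f-degree u))) (weight∙affine ρ b u w) ⟩
    a * dot u d + (b * (total u * c₁) + (dot u w * c₁ + (total u * total w - dot u w) * c₂))
      ≡⟨ cong₂ (λ x y → a * dot u d + (b * (total u * c₁) + (x * c₁ + (total u * y - x) * c₂))) (dot-w u) total-w ⟩
    -- As `total w` vanishes, `w` acts through c₁ - c₂, and (ν - 1)(c₁ - c₂) = q c₁; this is why `w`
    -- carries the factor `ν - 1ℤ`.
    _ ≡⟨ lem₃ (+ k) (+ m) c₁ c₂ h (total u) (dot u d) ⟩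
    (ρ * h * total u - ν * dot u d) * (+ k * c₁ - (ν - 1ℤ) * c₂)
      ≡⟨ cong (λ x → (ρ * h * total u - ν * dot u d) * (x - (ν - 1ℤ) * c₂)) kc₁≡[ν-1]c₂ ⟩
    (ρ * h * total u - ν * dot u d) * ((ν - 1ℤ) * c₂ - (ν - 1ℤ) * c₂)
      ≡⟨ lem₂ (ρ * h * total u - ν * dot u d) ((ν - 1ℤ) * c₂) ⟩
    0ℤ ∎
    where
    open ≡-Reasoning
    lem₁ : ∀ ν q c₁ ρ h c₀ → ν * q * c₁ * h + (- (ρ * q * h) * c₀ + 0ℤ * c₁) ≡ q * h * (ν * c₁ - ρ * c₀)
    lem₁ = solve-∀
    lem₂ : ∀ x y → x * (y - y) ≡ 0ℤ
    lem₂ = solve-∀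
    lem₃ : ∀ k m c₁ c₂ h tu ud → let ρ = 1ℤ + k; ν = 1ℤ + (1ℤ + (k + k + m)); q = 1ℤ + k + m; x = (ν - 1ℤ) * (ρ * h * tu - ν * ud) in
      ν * q * c₁ * ud + (- (ρ * q * h) * (tu * c₁) + (x * c₁ + (tu * 0ℤ - x) * c₂))
      ≡ (ρ * h * tu - ν * ud) * (k * c₁ - (ν - 1ℤ) * c₂)
    lem₃ = solve-∀

  -- `g` is orthogonal to its own affine part `θ`, so only the pairing with `a * f` survives.
  norm-g : g ∙ g ≡ a * Z
  norm-g = begin
    g ∙ g ≡⟨ ∙-+ʳ g (λ S → a * f S) θ ⟩
    g ∙ (λ S → a * f S) + g ∙ θ ≡⟨ cong₂ _+_ (∙-*ʳ a g f) (∙affine g-level b w) ⟩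
    a * g ∙ f + (b * ∑ g + weight w ∙ g)
      ≡⟨ cong₂ (λ x y → a * g ∙ f + (b * x + y)) (proj₁ g-orthogonal) (proj₂ g-orthogonal w) ⟩
    a * g ∙ f + (b * 0ℤ + 0ℤ) ≡⟨ lem a (g ∙ f) b ⟩
    a * g ∙ f ≡⟨ cong (λ x → a * x) (trans (∙-comm g f) (∙-+ʳ f (λ S → a * f S) θ)) ⟩
    a * (f ∙ (λ S → a * f S) + f ∙ θ) ≡⟨ cong (λ x → a * x) (cong₂ _+_ (trans (∙-*ʳ a f f) (cong (λ x → a * x) (∑-cong f-idem)))
       (trans (∙affine f-level b w) (cong (λ x → b * h + x) dot-wd))) ⟩
    a * (a * h + (b * h + T)) ≡⟨ cong (λ x → a * x) (sym (+-assoc (a * h) (b * h) T)) ⟩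
    a * Z ∎
    where
    open ≡-Reasoning
    lem : ∀ a x b → a * x + (b * 0ℤ + 0ℤ) ≡ a * x
    lem = solve-∀

  -- Λᵢ = (n − r − i)! / (r − i)! is m! times the i-th disjointness eigenvalue C(n − r − i, r − i) up to sign.
  Λ₀ Λ₁ Λ₂ : ℤ
  Λ₀ = rising (suc (suc k)) m
  Λ₁ = rising (suc k) m
  Λ₂ = rising k m

  G : Subset (order k m) → ℤ
  G = up^ m g

  -- By `f-cross` the part of `G` coming from `f` drops out. The affine part is explicit, and the
  -- sign of `Λ₁` appears because a weight of total zero changes sign under complementation.
  f∙G : ∑ (λ S → f S * G (∁ S)) ≡ Λ₀ * b * h - Λ₁ * T
  f∙G = begin
    ∑ (λ S → f S * G (∁ S)) ≡⟨ ∑-cong (λ S → pointwise S) ⟩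
    f ∙ affine ρ (Λ₀ * b) (λ i → - Λ₁ * w i) ≡⟨ ∙affine f-level (Λ₀ * b) (λ i → - Λ₁ * w i) ⟩
    Λ₀ * b * h + weight (λ i → - Λ₁ * w i) ∙ f
      ≡⟨ cong (λ x → Λ₀ * b * h + x) (trans (∑-cong λ S → trans (cong (_* f S) (weight-* (- Λ₁) w S)) (*-assoc (- Λ₁) (weight w S) (f S)))
           (trans (∑-* (- Λ₁) _) (cong (λ x → - Λ₁ * x) dot-wd))) ⟩
    Λ₀ * b * h + - Λ₁ * T ≡⟨ cong (λ x → Λ₀ * b * h + x) (sym (neg-distribˡ-* Λ₁ T)) ⟩
    Λ₀ * b * h - Λ₁ * T ∎
    where
    open ≡-Reasoning
    lem₁ : ∀ x a y z → x * (a * y + z) ≡ a * (x * y) + x * z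
    lem₁ = solve-∀
    lem₂ : ∀ l₀ l₁ b y → l₀ * b + l₁ * (0ℤ - y) ≡ l₀ * b + - l₁ * y
    lem₂ = solve-∀
    m+ρ+ρ : + (m ℕ.+ suc k) + ρ ≡ ν
    m+ρ+ρ = lem (+ m) (+ k)
      where lem : ∀ m k → m + (1ℤ + k) + (1ℤ + k) ≡ 1ℤ + (1ℤ + (k + k + m))
            lem = solve-∀
    pointwise : ∀ S → f S * G (∁ S) ≡ f S * affine ρ (Λ₀ * b) (λ i → - Λ₁ * w i) S
    pointwise S = begin
      f S * G (∁ S) ≡⟨ cong (λ x → f S * x) (up^-combination m a f θ (∁ S)) ⟩
      f S * (a * up^ m f (∁ S) + up^ m θ (∁ S)) ≡⟨ lem₁ (f S) a (up^ m f (∁ S)) (up^ m θ (∁ S)) ⟩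
      a * (f S * up^ m f (∁ S)) + f S * up^ m θ (∁ S) ≡⟨ cong (λ x → a * x + f S * up^ m θ (∁ S)) (f-cross S) ⟩
      a * 0ℤ + f S * up^ m θ (∁ S) ≡⟨ trans (cong (_+ f S * up^ m θ (∁ S)) (*-zeroʳ a)) (+-identityˡ _) ⟩
      f S * up^ m θ (∁ S) ≡⟨ cong (λ x → f S * x) (up^-affine m (suc k) b w (∁ S)) ⟩
      f S * (χ (+ (m ℕ.+ suc k)) (∁ S) * (Λ₀ * b + Λ₁ * weight w (∁ S)))
        ≡⟨ cong₂ (λ x y → f S * (x * (Λ₀ * b + Λ₁ * y))) (χ-∁ S m+ρ+ρ) (trans (weight-∁ w S) (cong (_- weight w S) total-w)) ⟩
      f S * (χ ρ S * (Λ₀ * b + Λ₁ * (0ℤ - weight w S)))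
        ≡⟨ cong (λ x → f S * (χ ρ S * x)) (trans (lem₂ Λ₀ Λ₁ b (weight w S)) (cong (λ x → Λ₀ * b + x) (sym (weight-* (- Λ₁) w S)))) ⟩
      f S * affine ρ (Λ₀ * b) (λ i → - Λ₁ * w i) S ∎

  -- The complement of an affine function is affine, and `G` inherits orthogonality from `g`.
  θ∙G : ∑ (λ S → θ S * G (∁ S)) ≡ 0ℤ
  θ∙G = begin
    ∑ (λ S → θ S * G (∁ S)) ≡⟨ ∑-adjoint-∁ θ G ⟩
    ∑ (λ S → θ (∁ S) * G S) ≡⟨ ∑-cong (λ S → trans (*-comm (θ (∁ S)) (G S)) (cong (λ x → G S * x) (θ-∁ S))) ⟩
    G ∙ affine (+ m + ρ) b (λ i → - 1ℤ * w i) ≡⟨ ∙affine (up^-Level m g-level) b (λ i → - 1ℤ * w i) ⟩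
    b * ∑ G + weight (λ i → - 1ℤ * w i) ∙ G
      ≡⟨ cong₂ (λ x y → b * x + y) (proj₁ G-orthogonal) (proj₂ G-orthogonal (λ i → - 1ℤ * w i)) ⟩
    b * 0ℤ + 0ℤ ≡⟨ cong (_+ 0ℤ) (*-zeroʳ b) ⟩
    0ℤ ∎
    where
    open ≡-Reasoning
    G-orthogonal : Orthogonal G
    G-orthogonal = up^-Orthogonal m g-level g-orthogonal
    lem : ∀ m k → 1ℤ + k + (m + (1ℤ + k)) ≡ 1ℤ + (1ℤ + (k + k + m))
    lem = solve-∀
    lem₂ : ∀ b y → b + (0ℤ - y) ≡ b + - 1ℤ * y
    lem₂ = solve-∀
    θ-∁ : ∀ S → θ (∁ S) ≡ affine (+ m + ρ) b (λ i → - 1ℤ * w i) S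
    θ-∁ S = cong₂ _*_ (χ-∁ S (lem (+ m) (+ k)))
      (trans (cong (λ x → b + x) (trans (weight-∁ w S) (cong (_- weight w S) total-w)))
        (trans (lem₂ b (weight w S)) (cong (λ x → b + x) (sym (weight-* (- 1ℤ) w S)))))

  g∙G : ∑ (λ S → g S * G (∁ S)) ≡ a * (Λ₀ * b * h - Λ₁ * T)
  g∙G = begin
    ∑ (λ S → (a * f S + θ S) * G (∁ S)) ≡⟨ ∑-cong (λ S → lem a (f S) (θ S) (G (∁ S))) ⟩
    ∑ (λ S → a * (f S * G (∁ S)) + θ S * G (∁ S)) ≡⟨ ∑-+ _ _ ⟩
    ∑ (λ S → a * (f S * G (∁ S))) + ∑ (λ S → θ S * G (∁ S)) ≡⟨ cong₂ _+_ (∑-* a _) θ∙G ⟩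
    a * ∑ (λ S → f S * G (∁ S)) + 0ℤ ≡⟨ +-identityʳ _ ⟩
    a * ∑ (λ S → f S * G (∁ S)) ≡⟨ cong (λ x → a * x) f∙G ⟩
    a * (Λ₀ * b * h - Λ₁ * T) ∎
    where
    open ≡-Reasoning
    lem : ∀ a x y z → (a * x + y) * z ≡ a * (x * z) + y * z
    lem = solve-∀

  -- For n = 2r + m the two rising products of the contraction coincide.
  norm-G : G ∙ G ≤ Λ₂ * (Λ₂ * g ∙ g)
  norm-G = up^-contraction m k k (ℕₚ.+-comm 2 (k ℕ.+ k ℕ.+ m)) g-level g-orthogonal

  module _ {{_ : Positive Λ₂}} {{_ : Positive c₁}} where
    instance
      a-positive : Positive a
      a-positive = *-positive (ν * q) c₁ {{*-positive ν q}}

    Z-nonneg : 0ℤ ≤ Z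
    Z-nonneg = nonneg-cancel a (subst (0ℤ ≤_) norm-g (norm-nonneg g))

    -- The disjointness form is at least -Λ₂‖g‖²: expand ‖Λ₂ g + G ∘ ∁‖² ≥ 0, bound ‖G‖² by
    -- `norm-G`, and cancel 2 Λ₂ a.
    Λ-inequality : 0ℤ ≤ Λ₂ * Z + (Λ₀ * b * h - Λ₁ * T)
    Λ-inequality = nonneg-cancel a (nonneg-cancel (Λ₂ + Λ₂) {{+-positive Λ₂ Λ₂}} (begin
      0ℤ ≤⟨ norm-nonneg (λ S → Λ₂ * g S + G∁ S) ⟩
      (λ S → Λ₂ * g S + G∁ S) ∙ (λ S → Λ₂ * g S + G∁ S) ≡⟨ norm-combination Λ₂ g G∁ ⟩
      Λ₂ * Λ₂ * g ∙ g + (Λ₂ + Λ₂) * g ∙ G∁ + G∁ ∙ G∁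
        ≡⟨ cong (λ x → Λ₂ * Λ₂ * g ∙ g + (Λ₂ + Λ₂) * g ∙ G∁ + x) (∑-∁ (λ S → G S * G S)) ⟩
      Λ₂ * Λ₂ * g ∙ g + (Λ₂ + Λ₂) * g ∙ G∁ + G ∙ G
        ≤⟨ +-monoʳ-≤ (Λ₂ * Λ₂ * g ∙ g + (Λ₂ + Λ₂) * g ∙ G∁) norm-G ⟩
      Λ₂ * Λ₂ * g ∙ g + (Λ₂ + Λ₂) * g ∙ G∁ + Λ₂ * (Λ₂ * g ∙ g)
        ≡⟨ cong₂ (λ x y → Λ₂ * Λ₂ * x + (Λ₂ + Λ₂) * y + Λ₂ * (Λ₂ * x)) norm-g g∙G ⟩
      Λ₂ * Λ₂ * (a * Z) + (Λ₂ + Λ₂) * (a * (Λ₀ * b * h - Λ₁ * T)) + Λ₂ * (Λ₂ * (a * Z))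
        ≡⟨ lem Λ₂ a Z (Λ₀ * b * h - Λ₁ * T) ⟩
      (Λ₂ + Λ₂) * (a * (Λ₂ * Z + (Λ₀ * b * h - Λ₁ * T))) ∎))
      where
      open ≤-Reasoning
      G∁ : Subset (order k m) → ℤ
      G∁ S = G (∁ S)
      lem : ∀ l a z e → l * l * (a * z) + (l + l) * (a * e) + l * (l * (a * z)) ≡ (l + l) * (a * (l * z + e))
      lem = solve-∀

    D E : ℤ
    D = c₁ - h
    E = ν * q * h * D

    -- Eliminate `T` through the definition of `Z`. The relations (k + m) Λ₂ = k Λ₁ and ρ Λ₀ = q Λ₁
    -- then leave `Λ₁` as a common factor.
    mZ≤ : + m * Z ≤ (+ k + + m) * E
    mZ≤ = 0≤i-j⇒j≤i (nonneg-cancel Λ₁ {{rising-pos k m}} (begin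
      0ℤ ≡⟨ *-zeroʳ (+ k + + m) ⟨
      (+ k + + m) * 0ℤ ≤⟨ *-monoˡ-≤-nonNeg (+ k + + m) Λ-inequality ⟩
      (+ k + + m) * (Λ₂ * Z + (Λ₀ * b * h - Λ₁ * T)) ≡⟨ lem₁ (+ k + + m) Λ₂ Z Λ₀ ρ q h Λ₁ T ⟩
      (+ k + + m) * Λ₂ * Z - (+ k + + m) * (ρ * Λ₀ * (q * h * h) + Λ₁ * T)
        ≡⟨ cong₂ (λ x y → x * Z - (+ k + + m) * (y * (q * h * h) + Λ₁ * T)) (sym (rising-last k m)) (rising-last (suc k) m) ⟩
      + k * Λ₁ * Z - (+ k + + m) * (q * Λ₁ * (q * h * h) + Λ₁ * T)
        ≡⟨ lem₂ (+ k) (+ m) Λ₁ c₁ h T ⟩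
      Λ₁ * ((+ k + + m) * E - + m * Z) ∎))
      where
      open ≤-Reasoning
      lem₁ : ∀ s l₂ z l₀ ρ q h l₁ t → s * (l₂ * z + (l₀ * - (ρ * q * h) * h - l₁ * t))
        ≡ s * l₂ * z - s * (ρ * l₀ * (q * h * h) + l₁ * t)
      lem₁ = solve-∀
      lem₂ : ∀ k m l c₁ h t → let ρ = 1ℤ + k; ν = 1ℤ + (1ℤ + (k + k + m)); q = 1ℤ + k + m; z = ν * q * c₁ * h + - (ρ * q * h) * h + t in
        k * l * z - (k + m) * (q * l * (q * h * h) + l * t)
        ≡ l * ((k + m) * (ν * q * h * (c₁ - h)) - m * z)
      lem₂ = solve-∀

    -- The number of non-edges, written as ‖χ - f‖².
    c₀-h-nonneg : 0ℤ ≤ c₀ - h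
    c₀-h-nonneg = begin
      0ℤ ≤⟨ norm-nonneg (λ S → - 1ℤ * f S + χ ρ S) ⟩
      (λ S → - 1ℤ * f S + χ ρ S) ∙ (λ S → - 1ℤ * f S + χ ρ S) ≡⟨ norm-combination (- 1ℤ) f (χ ρ) ⟩
      - 1ℤ * - 1ℤ * f ∙ f + (- 1ℤ + - 1ℤ) * f ∙ χ ρ + χ ρ ∙ χ ρ
        ≡⟨ cong₂ (λ x y → - 1ℤ * - 1ℤ * x + (- 1ℤ + - 1ℤ) * y + χ ρ ∙ χ ρ) (∑-cong f-idem) (∑-cong (Level-χ f-level)) ⟩
      - 1ℤ * - 1ℤ * h + (- 1ℤ + - 1ℤ) * h + χ ρ ∙ χ ρ
        ≡⟨ cong (λ x → - 1ℤ * - 1ℤ * h + (- 1ℤ + - 1ℤ) * h + x) (∑-cong (Level-χ (χ-Level ρ))) ⟩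
      - 1ℤ * - 1ℤ * h + (- 1ℤ + - 1ℤ) * h + c₀ ≡⟨ lem h c₀ ⟩
      c₀ - h ∎
      where
      open ≤-Reasoning
      lem : ∀ h c₀ → - 1ℤ * - 1ℤ * h + (- 1ℤ + - 1ℤ) * h + c₀ ≡ c₀ - h
      lem = solve-∀

    module _ {{_ : Positive (+ k)}} (k+m≤km : + k + + m ≤ + k * + m) where
      instance
        k+m-positive : Positive (+ k + + m)
        k+m-positive = +-pos-nonneg k m

      -- Trades the constant (k + m)/m for the larger k, the one occurring in `Y-identity`; the
      -- trade uses Z ≥ 0.
      Z≤kE : Z ≤ + k * E
      Z≤kE = *-cancelˡ-≤-pos Z (+ k * E) (+ k + + m) (begin
        (+ k + + m) * Z ≤⟨ *-monoʳ-≤-nonNeg Z {{nonNegative Z-nonneg}} k+m≤km ⟩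
        + k * + m * Z ≡⟨ *-assoc (+ k) (+ m) Z ⟩
        + k * (+ m * Z) ≤⟨ *-monoˡ-≤-nonNeg (+ k) mZ≤ ⟩
        + k * ((+ k + + m) * E) ≡⟨ lem (+ k) (+ k + + m) E ⟩
        (+ k + + m) * (+ k * E) ∎)
        where
        open ≤-Reasoning
        lem : ∀ k s e → k * (s * e) ≡ s * (k * e)
        lem = solve-∀

      module _ (μ : ℤ) (μ≥ : ρ * c₂ ≤ μ) (ore : 0ℤ ≤ ρ * h * c₁ - X - μ * (c₀ - h)) where

        Y : ℤ
        Y = ρ * h * c₁ - X - ρ * c₂ * (c₀ - h)

        Y-excess : (μ - ρ * c₂) * (c₀ - h) ≤ Y
        Y-excess = 0≤i-j⇒j≤i (subst (0ℤ ≤_) (lem (ρ * h * c₁ - X) μ (ρ * c₂) (c₀ - h)) ore)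
          where lem : ∀ e μ M x → e - μ * x ≡ e - M * x - (μ - M) * x
                lem = solve-∀

        excess-nonneg : 0ℤ ≤ (μ - ρ * c₂) * (c₀ - h)
        excess-nonneg = subst (_≤ (μ - ρ * c₂) * (c₀ - h)) (*-zeroʳ (μ - ρ * c₂))
          (*-monoˡ-≤-nonNeg (μ - ρ * c₂) {{nonNegative (i≤j⇒0≤j-i μ≥)}} c₀-h-nonneg)

        -- `X` enters `Z` only through `T`, with coefficient -ν (ν - 1), the same as on the left.
        -- Hence Y ≥ 0 is the lower bound on ‖g‖².
        Y-identity : ν * (ν - 1ℤ) * Y ≡ Z - ν * + k * ((ν * c₁ - ρ * h) * D)
        Y-identity = begin
          ν * (ν - 1ℤ) * Y ≡⟨ lem₁ ν ρ h c₁ X c₂ c₀ ⟩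
          ν * (ν - 1ℤ) * (ρ * h * c₁ - X) - ν * (ρ * c₀ - ρ * h) * ((ν - 1ℤ) * c₂)
            ≡⟨ cong₂ (λ x y → ν * (ν - 1ℤ) * (ρ * h * c₁ - X) - ν * (x - ρ * h) * y) ρc₀≡νc₁ (sym kc₁≡[ν-1]c₂) ⟩
          ν * (ν - 1ℤ) * (ρ * h * c₁ - X) - ν * (ν * c₁ - ρ * h) * (+ k * c₁)
            ≡⟨ lem₂ (+ k) (+ m) c₁ h X ⟩
          Z - ν * + k * ((ν * c₁ - ρ * h) * D) ∎
          where
          open ≡-Reasoning
          lem₁ : ∀ ν ρ h c₁ X c₂ c₀ → ν * (ν - 1ℤ) * (ρ * h * c₁ - X - ρ * c₂ * (c₀ - h))
            ≡ ν * (ν - 1ℤ) * (ρ * h * c₁ - X) - ν * (ρ * c₀ - ρ * h) * ((ν - 1ℤ) * c₂)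
          lem₁ = solve-∀
          lem₂ : ∀ k m c₁ h X → let ρ = 1ℤ + k; ν = 1ℤ + (1ℤ + (k + k + m)); q = 1ℤ + k + m in
            ν * (ν - 1ℤ) * (ρ * h * c₁ - X) - ν * (ν * c₁ - ρ * h) * (k * c₁)
            ≡ ν * q * c₁ * h + - (ρ * q * h) * h + (ν - 1ℤ) * (ρ * h * (ρ * h) - ν * X) - ν * k * ((ν * c₁ - ρ * h) * (c₁ - h))
          lem₂ = solve-∀

        -- The upper bound on `Z` meets the lower one: q h - (ν c₁ - ρ h) = -ν D because q + ρ = ν.
        Y≤-D² : ν * (ν - 1ℤ) * Y ≤ - (ν * ν * + k * (D * D))
        Y≤-D² = begin
          ν * (ν - 1ℤ) * Y ≡⟨ Y-identity ⟩
          Z - ν * + k * ((ν * c₁ - ρ * h) * D) ≤⟨ +-monoˡ-≤ (- (ν * + k * ((ν * c₁ - ρ * h) * D))) Z≤kE ⟩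
          + k * E - ν * + k * ((ν * c₁ - ρ * h) * D) ≡⟨ lem (+ k) (+ m) c₁ h ⟩
          - (ν * ν * + k * (D * D)) ∎
          where
          open ≤-Reasoning
          lem : ∀ k m c₁ h → let ρ = 1ℤ + k; ν = 1ℤ + (1ℤ + (k + k + m)); q = 1ℤ + k + m in
            k * (ν * q * h * (c₁ - h)) - ν * k * ((ν * c₁ - ρ * h) * (c₁ - h)) ≡ - (ν * ν * k * ((c₁ - h) * (c₁ - h)))
          lem = solve-∀

        D≡0 : D ≡ 0ℤ
        D≡0 = square-zero D (≤-antisym
          (neg-cancel-≤ (nonneg-cancel (ν * ν * + k) {{*-positive (ν * ν) (+ k) {{*-positive ν ν}}}} (begin
            0ℤ ≡⟨ *-zeroʳ (ν * (ν - 1ℤ)) ⟨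
            ν * (ν - 1ℤ) * 0ℤ ≤⟨ *-monoˡ-≤-nonNeg (ν * (ν - 1ℤ)) (≤-trans excess-nonneg Y-excess) ⟩
            ν * (ν - 1ℤ) * Y ≤⟨ Y≤-D² ⟩
            - (ν * ν * + k * (D * D)) ≡⟨ neg-distribʳ-* (ν * ν * + k) (D * D) ⟩
            ν * ν * + k * - (D * D) ∎)))
          (square-nonneg D))
          where open ≤-Reasoning

        h≡c₁ : h ≡ c₁
        h≡c₁ = sym (i-j≡0⇒i≡j c₁ h D≡0)

        Z≡0 : Z ≡ 0ℤ
        Z≡0 = ≤-antisym (≤-trans Z≤kE (≤-reflexive (begin
          + k * (ν * q * h * D) ≡⟨ cong (λ x → + k * (ν * q * h * x)) D≡0 ⟩
          + k * (ν * q * h * 0ℤ) ≡⟨ cong (λ x → + k * x) (*-zeroʳ (ν * q * h)) ⟩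
          + k * 0ℤ ≡⟨ *-zeroʳ (+ k) ⟩
          0ℤ ∎))) Z-nonneg
          where open ≡-Reasoning

        -- Non-edges exist, since h = c₁ and ρ (c₀ - c₁) = q c₁.
        c₀-h-positive : Positive (c₀ - h)
        c₀-h-positive = positive (*-cancelˡ-<-nonNeg ρ (begin-strict
          ρ * 0ℤ ≡⟨ *-zeroʳ ρ ⟩
          0ℤ <⟨ positive⁻¹ (q * c₁) {{*-positive q c₁}} ⟩
          q * c₁ ≡⟨ lem (+ k) (+ m) c₁ ⟩
          ν * c₁ - ρ * c₁ ≡⟨ cong₂ (λ x y → x - ρ * y) ρc₀≡νc₁ h≡c₁ ⟨
          ρ * c₀ - ρ * h ≡⟨ lem₂ ρ c₀ h ⟩
          ρ * (c₀ - h) ∎))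
          where
          open ≤-Reasoning
          lem : ∀ k m c₁ → let ρ = 1ℤ + k; ν = 1ℤ + (1ℤ + (k + k + m)); q = 1ℤ + k + m in q * c₁ ≡ ν * c₁ - ρ * c₁
          lem = solve-∀
          lem₂ : ∀ r x y → r * x - r * y ≡ r * (x - y)
          lem₂ = solve-∀

        -- `Y` is at least the excess of μ times the number of non-edges, and D = 0 forces Y ≤ 0.
        μ≡ρc₂ : μ ≡ ρ * c₂
        μ≡ρc₂ = i-j≡0⇒i≡j μ (ρ * c₂) (≤-antisym
          (*-cancelʳ-≤-pos (μ - ρ * c₂) 0ℤ (c₀ - h) {{c₀-h-positive}} (begin
            (μ - ρ * c₂) * (c₀ - h) ≤⟨ Y-excess ⟩
            Y ≤⟨ neg-cancel-≤ (nonneg-cancel (ν * (ν - 1ℤ)) {{*-positive ν (ν - 1ℤ)}} (begin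
              0ℤ ≤⟨ neg-mono-≤ (≤-trans Y≤-D² (≤-reflexive (cong -_ (trans (cong (λ x → ν * ν * + k * (x * x)) D≡0) (*-zeroʳ (ν * ν * + k)))))) ⟩
              - (ν * (ν - 1ℤ) * Y) ≡⟨ neg-distribʳ-* (ν * (ν - 1ℤ)) Y ⟩
              ν * (ν - 1ℤ) * - Y ∎)) ⟩
            0ℤ ≡⟨ *-zeroˡ (c₀ - h) ⟨
            0ℤ * (c₀ - h) ∎))
          (i≤j⇒0≤j-i μ≥))
          where open ≤-Reasoning

        f-affine : ∀ S → a * f S + affine ρ b w S ≡ 0ℤ
        f-affine = norm-zero g (trans norm-g (trans (cong (λ x → a * x) Z≡0) (*-zeroʳ a)))

        -- Z = 0 and h = c₁ determine `T`. Its being nonzero shows that `w` does not vanish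
        -- identically, so the affine function is not constant.
        T-negative : weight w ∙ f ≡ - (q * c₁ * (q * c₁))
        T-negative = trans dot-wd (begin
          T ≡⟨ lem₁ (a * h + b * h) T ⟩
          Z - (ν * q * c₁ * h + - (ρ * q * h) * h) ≡⟨ cong₂ (λ x y → x - (ν * q * c₁ * y + - (ρ * q * y) * y)) Z≡0 h≡c₁ ⟩
          0ℤ - (ν * q * c₁ * c₁ + - (ρ * q * c₁) * c₁) ≡⟨ lem₂ (+ k) (+ m) c₁ ⟩
          - (q * c₁ * (q * c₁)) ∎)
          where
          open ≡-Reasoning
          lem₁ : ∀ x t → t ≡ x + t - x
          lem₁ = solve-∀
          lem₂ : ∀ k m c₁ → let ρ = 1ℤ + k; ν = 1ℤ + (1ℤ + (k + k + m)); q = 1ℤ + k + m in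
            0ℤ - (ν * q * c₁ * c₁ + - (ρ * q * c₁) * c₁) ≡ - (q * c₁ * (q * c₁))
          lem₂ = solve-∀

-- Indicator functions of hypergraphs

δ : Subset n → Subset n → ℤ
δ [] [] = 1ℤ
δ (outside ∷ E) (outside ∷ S) = δ E S
δ (inside ∷ E) (inside ∷ S) = δ E S
δ (outside ∷ E) (inside ∷ S) = 0ℤ
δ (inside ∷ E) (outside ∷ S) = 0ℤ

δ-refl : (S : Subset n) → δ S S ≡ 1ℤ
δ-refl [] = refl
δ-refl (outside ∷ S) = δ-refl S
δ-refl (inside ∷ S) = δ-refl S

δ-off : (E S : Subset n) → E ≢ S → δ E S ≡ 0ℤ
δ-off [] [] neq = contradiction refl neq
δ-off (outside ∷ E) (outside ∷ S) neq = δ-off E S (neq ∘ cong (outside ∷_))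
δ-off (inside ∷ E) (inside ∷ S) neq = δ-off E S (neq ∘ cong (inside ∷_))
δ-off (outside ∷ E) (inside ∷ S) neq = refl
δ-off (inside ∷ E) (outside ∷ S) neq = refl

∙δ : (φ : Subset n → ℤ) (E : Subset n) → φ ∙ δ E ≡ φ E
∙δ φ [] = trans (∑-empty _) (*-identityʳ (φ []))
∙δ φ (outside ∷ E) = trans (∑-split _) (trans
  (cong₂ _+_ (∙δ (out φ) E) (∑-0 λ S → *-zeroʳ (inn φ S))) (+-identityʳ _))
∙δ φ (inside ∷ E) = trans (∑-split _) (trans
  (cong₂ _+_ (∑-0 λ S → *-zeroʳ (out φ S)) (∙δ (inn φ) E)) (+-identityˡ _))

_≟ˢ_ : (S T : Subset n) → Dec (S ≡ T)
_≟ˢ_ = ≡-dec _≟ᵇ_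

_∈ᴸ?_ : (S : Subset n) (Es : List (Subset n)) → Dec (S L.∈ Es)
_∈ᴸ?_ = DecMembership._∈?_ _≟ˢ_

-- The indicator as a sum over the edge list, which allows induction on the list; `Unique` makes its
-- values 0 and 1.
multiplicity : List (Subset n) → Subset n → ℤ
multiplicity [] S = 0ℤ
multiplicity (E ∷ Es) S = δ E S + multiplicity Es S

multiplicity-∉ : ∀ Es {S : Subset n} → ¬ (S L.∈ Es) → multiplicity Es S ≡ 0ℤ
multiplicity-∉ [] S∉ = refl
multiplicity-∉ (E ∷ Es) {S} S∉ = cong₂ _+_ (δ-off E S (λ eq → S∉ (here (sym eq)))) (multiplicity-∉ Es (S∉ ∘ there))

multiplicity-∈ : ∀ {Es} {S : Subset n} → Unique Es → S L.∈ Es → multiplicity Es S ≡ 1ℤ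
multiplicity-∈ {Es = E ∷ Es} (E∉ ∷ _) (here refl) =
  cong₂ _+_ (δ-refl E) (multiplicity-∉ Es λ E∈ → All.lookup E∉ E∈ refl)
multiplicity-∈ {Es = E ∷ Es} {S} (E∉ ∷ uniq) (there S∈) =
  cong₂ _+_ (δ-off E S (All.lookup E∉ S∈)) (multiplicity-∈ uniq S∈)

multiplicity-Level : ∀ Es k → (∀ {E : Subset n} → E L.∈ Es → size E ≡ k) → Level k (multiplicity Es)
Level.scale (multiplicity-Level Es k sizes) S with S ∈ᴸ? Es
... | yes S∈ = cong (_* multiplicity Es S) (sizes S∈)
... | no S∉ = trans (vanish (size S)) (sym (vanish k))
  where
  vanish : ∀ i → i * multiplicity Es S ≡ 0ℤ
  vanish i = trans (cong (λ x → i * x) (multiplicity-∉ Es S∉)) (*-zeroʳ i)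

side : Side → ℤ
side inside = 1ℤ
side outside = 0ℤ

indicator : Fin n → Subset n → ℤ
indicator i S = side (lookup S i)

dot-distribˡ : ∀ (u v w : Fin n → ℤ) → dot u (λ i → v i + w i) ≡ dot u v + dot u w
dot-distribˡ {zero} u v w = refl
dot-distribˡ {suc n} u v w = trans
  (cong₂ _+_ (*-distribˡ-+ (u zero) (v zero) (w zero)) (dot-distribˡ (u ∘ suc) (v ∘ suc) (w ∘ suc)))
  (swap-middle (u zero * v zero) (u zero * w zero) _ _)

dot-cong : ∀ (u : Fin n → ℤ) {v w} → (∀ i → v i ≡ w i) → dot u v ≡ dot u w
dot-cong u eq = total-cong λ i → cong (λ x → u i * x) (eq i)

weight≡dot : ∀ (w : Fin n → ℤ) S → weight w S ≡ dot w (λ i → indicator i S)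
weight≡dot w [] = refl
weight≡dot w (outside ∷ S) = trans (weight≡dot (w ∘ suc) S) (sym (trans
  (cong (_+ dot (w ∘ suc) (λ i → indicator i S)) (*-zeroʳ (w zero))) (+-identityˡ _)))
weight≡dot w (inside ∷ S) = cong₂ _+_ (sym (*-identityʳ (w zero))) (weight≡dot (w ∘ suc) S)

-- `deg` freed from the hypergraph record, so that edges can be removed one at a time.
degree : List (Subset n) → Fin n → ℕ
degree Es v = length (filter (λ E → v ∈? E) Es)

degree-∷ : ∀ (E : Subset n) Es v → + degree (E ∷ Es) v ≡ indicator v E + + degree Es v
degree-∷ E Es v with v ∈? E
... | yes v∈E rewrite []=⇒lookup v∈E = refl
... | no v∉E with lookup E v in eq
...   | inside = contradiction (lookup⇒[]= v E eq) v∉E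
...   | outside = refl

weight∙multiplicity : ∀ (w : Fin n → ℤ) Es → weight w ∙ multiplicity Es ≡ dot w (λ v → + degree Es v)
weight∙multiplicity {n} w [] = trans (∑-0 λ S → *-zeroʳ (weight w S)) (sym (dot-0 w))
  where
  dot-0 : ∀ {n} (w : Fin n → ℤ) → dot w (λ _ → 0ℤ) ≡ 0ℤ
  dot-0 {zero} w = refl
  dot-0 {suc n} w = cong₂ _+_ (*-zeroʳ (w zero)) (dot-0 (w ∘ suc))
weight∙multiplicity w (E ∷ Es) = begin
  weight w ∙ multiplicity (E ∷ Es) ≡⟨ ∙-+ʳ (weight w) (δ E) (multiplicity Es) ⟩
  weight w ∙ δ E + weight w ∙ multiplicity Es
    ≡⟨ cong₂ _+_ (trans (∙δ (weight w) E) (weight≡dot w E)) (weight∙multiplicity w Es) ⟩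
  dot w (λ v → indicator v E) + dot w (λ v → + degree Es v) ≡⟨ dot-distribˡ w _ _ ⟨
  dot w (λ v → indicator v E + + degree Es v) ≡⟨ dot-cong w (λ v → sym (degree-∷ E Es v)) ⟩
  dot w (λ v → + degree (E ∷ Es) v) ∎
  where open ≡-Reasoning

-- The list of vertices is generalised to `tabulate ι`: the induction consumes `S` while the filter
-- keeps testing the fixed set `T`.
sum-filter-∈ : ∀ {N} (c : Fin N → ℕ) (T : Subset N) (S : Subset n) (ι : Fin n → Fin N) →
  (∀ i → lookup T (ι i) ≡ lookup S i) →
  + sum (map c (filter (_∈? T) (tabulate ι))) ≡ weight (λ i → + c (ι i)) S
sum-filter-∈ c T [] ι eq = refl
sum-filter-∈ c T (s ∷ S) ι eq with ι zero ∈? T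
sum-filter-∈ c T (inside ∷ S) ι eq | yes _ =
  cong (λ x → + c (ι zero) + x) (sum-filter-∈ c T S (ι ∘ suc) (eq ∘ suc))
sum-filter-∈ c T (outside ∷ S) ι eq | yes ∈T with () ← trans (sym ([]=⇒lookup ∈T)) (eq zero)
sum-filter-∈ c T (inside ∷ S) ι eq | no ∉T = contradiction (lookup⇒[]= (ι zero) T (eq zero)) ∉T
sum-filter-∈ c T (outside ∷ S) ι eq | no _ = sum-filter-∈ c T S (ι ∘ suc) (eq ∘ suc)

weight-update : ∀ (w : Fin n → ℤ) S i s →
  weight w (S [ i ]≔ s) ≡ weight w S + w i * (side s - side (lookup S i))
weight-update w (t ∷ S) (suc i) s = step t
  where
  lem : ∀ a x y → a + (x + y) ≡ a + x + y
  lem = solve-∀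
  step : ∀ t → weight w (t ∷ S [ i ]≔ s) ≡ weight w (t ∷ S) + w (suc i) * (side s - side (lookup S i))
  step outside = weight-update (w ∘ suc) S i s
  step inside = trans (cong (λ x → w zero + x) (weight-update (w ∘ suc) S i s)) (lem (w zero) _ _)
weight-update w (outside ∷ S) zero outside = lem (w zero) (weight (w ∘ suc) S)
  where lem : ∀ a x → x ≡ x + a * (0ℤ - 0ℤ)
        lem = solve-∀
weight-update w (outside ∷ S) zero inside = lem (w zero) (weight (w ∘ suc) S)
  where lem : ∀ a x → a + x ≡ x + a * (1ℤ - 0ℤ)
        lem = solve-∀
weight-update w (inside ∷ S) zero outside = lem (w zero) (weight (w ∘ suc) S)
  where lem : ∀ a x → x ≡ a + x + a * (0ℤ - 1ℤ)
        lem = solve-∀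
weight-update w (inside ∷ S) zero inside = lem (w zero) (weight (w ∘ suc) S)
  where lem : ∀ a x → a + x ≡ a + x + a * (1ℤ - 1ℤ)
        lem = solve-∀

∉⇒lookup : ∀ {i} {S : Subset n} → i ∉ S → lookup S i ≡ outside
∉⇒lookup {i = i} {S} i∉S with lookup S i in eq
... | inside = contradiction (lookup⇒[]= i S eq) i∉S
... | outside = refl

weight-exchange : ∀ (w : Fin n → ℤ) S {i j} → i ∈ S → j ∉ S →
  weight w (S [ i ]≔ outside [ j ]≔ inside) ≡ weight w S + (w j - w i)
weight-exchange w S {i} {j} i∈S j∉S = begin
  weight w (S [ i ]≔ outside [ j ]≔ inside)
    ≡⟨ weight-update w (S [ i ]≔ outside) j inside ⟩
  weight w (S [ i ]≔ outside) + w j * (1ℤ - side (lookup (S [ i ]≔ outside) j))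
    ≡⟨ cong₂ (λ x s → x + w j * (1ℤ - side s)) (weight-update w S i outside)
        (trans (lookup∘update′ j≢i S outside) (∉⇒lookup j∉S)) ⟩
  weight w S + w i * (0ℤ - side (lookup S i)) + w j * (1ℤ - 0ℤ)
    ≡⟨ cong (λ s → weight w S + w i * (0ℤ - side s) + w j * (1ℤ - 0ℤ)) ([]=⇒lookup i∈S) ⟩
  weight w S + w i * (0ℤ - 1ℤ) + w j * (1ℤ - 0ℤ) ≡⟨ lem (weight w S) (w i) (w j) ⟩
  weight w S + (w j - w i) ∎
  where
  open ≡-Reasoning
  j≢i : j ≢ i
  j≢i refl = j∉S i∈S
  lem : ∀ x a b → x + a * (0ℤ - 1ℤ) + b * (1ℤ - 0ℤ) ≡ x + (b - a)
  lem = solve-∀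

-- Greedy choice: an element of `B` outside `A` is left out as long as the rest of `B` can still
-- supply `r` elements.
between : ∀ (A B : Subset n) r → A ⊆ B → ∣ A ∣ ℕ.≤ r → r ℕ.≤ ∣ B ∣ →
  ∃ λ E → A ⊆ E × E ⊆ B × ∣ E ∣ ≡ r
between [] [] zero A⊆B _ _ = [] , A⊆B , A⊆B , refl
between (inside ∷ A) (outside ∷ B) r A⊆B _ _ with () ← A⊆B here
between (inside ∷ A) (inside ∷ B) (suc r) A⊆B (ℕ.s≤s p) (ℕ.s≤s q)
  with E , A⊆E , E⊆B , eq ← between A B r (drop-∷-⊆ A⊆B) p q =
  inside ∷ E , s⊆s A⊆E , s⊆s E⊆B , cong suc eq
between (outside ∷ A) (outside ∷ B) r A⊆B p q
  with E , A⊆E , E⊆B , eq ← between A B r (drop-∷-⊆ A⊆B) p q =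
  outside ∷ E , s⊆s A⊆E , s⊆s E⊆B , eq
between (outside ∷ A) (inside ∷ B) r A⊆B p q with r ℕₚ.≤? ∣ B ∣
... | yes r≤ with E , A⊆E , E⊆B , eq ← between A B r (drop-∷-⊆ A⊆B) p r≤ =
  outside ∷ E , s⊆s A⊆E , out⊆ E⊆B , eq
... | no r≰ = inside ∷ B , A⊆B , (λ x → x) , ℕₚ.≤-antisym (ℕₚ.≰⇒> r≰) q

-- From affine indicator functions to stars

∣∣-exchange : ∀ (S : Subset n) {i j} → i ∈ S → j ∉ S → ∣ S [ i ]≔ outside [ j ]≔ inside ∣ ≡ ∣ S ∣
∣∣-exchange S {i} {j} i∈S j∉S = +-injective (begin
  + ∣ S [ i ]≔ outside [ j ]≔ inside ∣ ≡⟨ size≡∣∣ (S [ i ]≔ outside [ j ]≔ inside) ⟨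
  size (S [ i ]≔ outside [ j ]≔ inside) ≡⟨ weight-exchange (λ _ → 1ℤ) S i∈S j∉S ⟩
  size S + 0ℤ ≡⟨ +-identityʳ (size S) ⟩
  size S ≡⟨ size≡∣∣ S ⟩
  + ∣ S ∣ ∎)
  where open ≡-Reasoning

∣insert∣≤ : ∀ (S : Subset n) i → ∣ S [ i ]≔ inside ∣ ℕ.≤ suc ∣ S ∣
∣insert∣≤ (inside ∷ S) zero = ℕₚ.n≤1+n _
∣insert∣≤ (outside ∷ S) zero = ℕₚ.≤-refl
∣insert∣≤ (inside ∷ S) (suc i) = ℕ.s≤s (∣insert∣≤ S i)
∣insert∣≤ (outside ∷ S) (suc i) = ∣insert∣≤ S i

∈-insert : ∀ (S : Subset n) i {x} → x ∈ S → x ∈ S [ i ]≔ inside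
∈-insert S i {x} x∈S with x Fin.≟ i
... | yes refl = lookup⇒[]= i _ (lookup∘update i S inside)
... | no x≢i = lookup⇒[]= x _ (trans (lookup∘update′ x≢i S inside) ([]=⇒lookup x∈S))

avoiding : ∀ (A : Subset n) {x y} r → x ∉ A → x ≢ y → 1 ℕ.≤ r → suc ∣ A ∣ ℕ.+ r ℕ.≤ n →
  ∃ λ E → x ∈ E × y ∉ E × ∣ E ∣ ≡ r × (∀ {z} → z ∈ E → z ∉ A)
avoiding {n} A {x} {y} r x∉A x≢y 1≤r bound =
  let B = A [ y ]≔ inside
      E , x⊆E , E⊆∁B , ∣E∣≡r = between ⁅ x ⁆ (∁ B) r
        (λ {z} z∈ → subst (_∈ ∁ B) (sym (x∈⁅y⁆⇒x≡y x z∈)) (x∉p⇒x∈∁p (x∉B B refl)))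
        (subst (ℕ._≤ r) (sym (∣⁅x⁆∣≡1 x)) 1≤r)
        (subst (r ℕ.≤_) (sym (∣∁p∣≡n∸∣p∣ B)) (ℕₚ.m+n≤o⇒m≤o∸n r
          (ℕₚ.≤-trans (ℕₚ.+-monoʳ-≤ r (∣insert∣≤ A y)) (subst (ℕ._≤ n) (ℕₚ.+-comm (suc ∣ A ∣) r) bound))))
  in E , x⊆E (x∈⁅x⁆ x)
    , (λ y∈E → x∈∁p⇒x∉p (E⊆∁B y∈E) (lookup⇒[]= y B (lookup∘update y A inside)))
    , ∣E∣≡r
    , λ z∈E z∈A → x∈∁p⇒x∉p (E⊆∁B z∈E) (∈-insert A y z∈A)
  where
  x∉B : ∀ B → B ≡ A [ y ]≔ inside → x ∉ B
  x∉B _ refl x∈B = x∉A (lookup⇒[]= x A (trans (sym (lookup∘update′ x≢y A inside)) ([]=⇒lookup x∈B)))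

missing : ∀ (S : Subset n) → ∣ S ∣ ℕ.< n → ∃ λ x → x ∉ S
missing {n} S ∣S∣<n with nonempty? (∁ S)
... | yes (x , x∈) = x , x∈∁p⇒x∉p x∈
... | no empty = contradiction (begin-strict
  0 <⟨ ℕₚ.m<n⇒0<n∸m ∣S∣<n ⟩
  n ∸ ∣ S ∣ ≡⟨ ∣∁p∣≡n∸∣p∣ S ⟨
  ∣ ∁ S ∣ ≡⟨ cong ∣_∣ (Empty-unique empty) ⟩
  ∣ ⊥ {n} ∣ ≡⟨ ∣⊥∣≡0 n ⟩
  0 ∎) λ ()
  where open ℕₚ.≤-Reasoning

module _ (H : Hypergraph n r) (intersecting : Intersecting H) (w : Fin n → ℤ)
  (1≤r : 1 ℕ.≤ r) (2r<n : suc r ℕ.+ r ℕ.≤ n)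
  -- A function with values 0 and 1 that strictly decreases with the weight leaves no other
  -- possibility.
  (separated : ∀ S T → ∣ S ∣ ≡ r → ∣ T ∣ ≡ r → weight w T < weight w S → T L.∈ edges H × ¬ (S L.∈ edges H)) where

  -- Replacing `v` by the heavier `u` yields a heavier set, so `S` is the lighter of a separated
  -- pair.
  light⇒edge : ∀ {S u v} → ∣ S ∣ ≡ r → v ∈ S → u ∉ S → w v < w u → S L.∈ edges H
  light⇒edge {S} {u} {v} ∣S∣ v∈S u∉S wv<wu =
    proj₁ (separated (S [ v ]≔ outside [ u ]≔ inside) S (trans (∣∣-exchange S v∈S u∉S) ∣S∣) ∣S∣ (begin-strict
      weight w S ≡⟨ +-identityʳ (weight w S) ⟨
      weight w S + 0ℤ <⟨ +-monoʳ-< (weight w S) (subst (_< w u - w v) (+-inverseʳ (w v)) (+-monoˡ-< (- w v) wv<wu)) ⟩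
      weight w S + (w u - w v) ≡⟨ weight-exchange w S v∈S u∉S ⟨
      _ ∎))
    where
    open ≤-Reasoning

  heavy⇒nonedge : ∀ {S u v} → ∣ S ∣ ≡ r → u ∈ S → v ∉ S → w v < w u → ¬ (S L.∈ edges H)
  heavy⇒nonedge {S} {u} {v} ∣S∣ u∈S v∉S wv<wu =
    proj₂ (separated S (S [ u ]≔ outside [ v ]≔ inside) ∣S∣ (trans (∣∣-exchange S u∈S v∉S) ∣S∣) (begin-strict
      _ ≡⟨ weight-exchange w S u∈S v∉S ⟩
      weight w S + (w v - w u) <⟨ +-monoʳ-< (weight w S) (subst (w v - w u <_) (+-inverseʳ (w u)) (+-monoˡ-< (- w u) wv<wu)) ⟩
      weight w S + 0ℤ ≡⟨ +-identityʳ (weight w S) ⟩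
      weight w S ∎))
    where open ≤-Reasoning

  -- If some other `z` were no heavier than `v`, both would be lighter than `u`. An r-set through
  -- `v` and a disjoint one through `z`, both missing `u`, would then be disjoint edges; 2r + 1
  -- vertices leave room for them.
  lightest : ∀ {u v} → w v < w u → ∀ z → z ≢ v → w v < w z
  lightest {u} {v} wv<wu z z≢v with w v <? w z
  ... | yes wv<wz = wv<wz
  ... | no wv≮wz =
    let wz<wu = ≤-<-trans (≮⇒≥ wv≮wz) wv<wu
        z≢u : z ≢ u
        z≢u = λ { refl → <-irrefl refl wz<wu }
        v≢u : v ≢ u
        v≢u = λ { refl → <-irrefl refl wv<wu }
        E , v∈E , u∉E , ∣E∣ , avoidz = avoiding ⁅ z ⁆ r (λ v∈ → z≢v (sym (x∈⁅y⁆⇒x≡y z v∈))) v≢u 1≤r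
          (ℕₚ.≤-trans (subst (λ i → suc i ℕ.+ r ℕ.≤ suc r ℕ.+ r) (sym (∣⁅x⁆∣≡1 z)) (ℕₚ.+-monoˡ-≤ r (ℕ.s≤s 1≤r))) 2r<n)
        F , z∈F , u∉F , ∣F∣ , avoidE = avoiding E r (λ z∈E → avoidz z∈E (x∈⁅x⁆ z)) z≢u 1≤r
          (subst (λ i → suc i ℕ.+ r ℕ.≤ n) (sym ∣E∣) 2r<n)
        x , x∈E∩F = intersecting (light⇒edge ∣E∣ v∈E u∉E wv<wu) (light⇒edge ∣F∣ z∈F u∉F wz<wu)
        x∈E , x∈F = x∈p∩q⁻ E F x∈E∩F
    in contradiction x∈E (avoidE x∈F)

  star : ∀ {u v} → w v < w u → IsOneStar H
  star {u} {v} wv<wu = v , λ S → mk⇔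
    (λ S∈ → uniform H S∈ , contains S∈)
    (λ (∣S∣ , v∈S) → let u′ , u′∉S = missing S (subst (ℕ._< n) (sym ∣S∣) (ℕₚ.≤-trans (ℕₚ.m≤m+n (suc r) r) 2r<n))
                     in light⇒edge ∣S∣ v∈S u′∉S (lightest wv<wu u′ λ u′≡v → u′∉S (subst (_∈ S) (sym u′≡v) v∈S)))
    where
    contains : ∀ {S} → S L.∈ edges H → v ∈ S
    contains {S} S∈ with v ∈? S
    ... | yes v∈S = v∈S
    -- An edge meets itself, hence has an element `x`, which is heavier than `v`.
    ... | no v∉S with x , x∈ ← intersecting S∈ S∈ with x∈S , _ ← x∈p∩q⁻ S S x∈ =
      contradiction S∈ (heavy⇒nonedge (uniform H S∈) x∈S v∉S (lightest wv<wu x λ { refl → v∉S x∈S }))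

total-const : ∀ n c → total {n} (λ _ → c) ≡ + n * c
total-const zero c = sym (*-zeroˡ c)
total-const (suc n) c = trans (cong (λ x → c + x) (total-const n c)) (lem (+ n) c)
  where lem : ∀ n c → c + n * c ≡ (1ℤ + n) * c
        lem = solve-∀

weight-zero : ∀ {w : Fin n → ℤ} → (∀ i → w i ≡ 0ℤ) → ∀ S → weight w S ≡ 0ℤ
weight-zero eq [] = refl
weight-zero eq (outside ∷ S) = weight-zero (eq ∘ suc) S
weight-zero eq (inside ∷ S) = cong₂ _+_ (eq zero) (weight-zero (eq ∘ suc) S)

-- A constant weight of total zero is zero and would pair to zero with `f`.
nonconstant : ∀ (w : Fin (suc n) → ℤ) {f : Subset (suc n) → ℤ} → total w ≡ 0ℤ → weight w ∙ f < 0ℤ →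
  ∃ λ u → ∃ λ v → w v < w u
nonconstant {n} w {f} total≡0 negative with Fin.any? (λ u → Fin.any? (λ v → w v <? w u))
... | yes p = p
... | no ¬p = contradiction (∑-0 λ S → cong (_* f S) (weight-zero w≡0 S)) (<⇒≢ negative)
  where
  open ≡-Reasoning
  constant : ∀ i → w i ≡ w zero
  constant i = ≤-antisym (≮⇒≥ λ lt → ¬p (i , zero , lt)) (≮⇒≥ λ lt → ¬p (zero , i , lt))
  w₀≡0 : w zero ≡ 0ℤ
  w₀≡0 = *-cancelˡ-≡ (+ suc n) (w zero) 0ℤ (begin
    + suc n * w zero ≡⟨ total-const (suc n) (w zero) ⟨
    total {suc n} (λ _ → w zero) ≡⟨ total-cong constant ⟨
    total w ≡⟨ total≡0 ⟩
    0ℤ ≡⟨ *-zeroʳ (+ suc n) ⟨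
    + suc n * 0ℤ ∎)
  w≡0 : ∀ i → w i ≡ 0ℤ
  w≡0 i = trans (constant i) w₀≡0

-- The Ore-degree and the conclusion

nonEdge? : ∀ (H : Hypergraph n r) S → Dec (NonEdge H S)
nonEdge? {r = r} H S = (∣ S ∣ ℕₚ.≟ r) ×-dec ¬? (S ∈ᴸ? edges H)

minimal : ∀ {P : Subset n → Set} → (∀ S → Dec (P S)) → (c : Subset n → ℕ) → ∀ S → P S →
  ∃ λ S → P S × (∀ T → P T → c S ℕ.≤ c T)
minimal {n} {P} P? c S pS = search (c S) S pS ℕₚ.≤-refl
  where
  search : ∀ bound S → P S → c S ℕ.≤ bound → ∃ λ S → P S × (∀ T → P T → c S ℕ.≤ c T)
  search bound S pS cS≤ with anySubset? (λ T → P? T ×-dec (c T ℕₚ.<? c S))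
  ... | no none = S , pS , λ T pT → ℕₚ.≮⇒≥ λ cT<cS → none (T , pT , cT<cS)
  search zero S pS cS≤ | yes (T , pT , cT<cS) = contradiction (ℕₚ.<-≤-trans cT<cS cS≤) λ ()
  search (suc bound) S pS cS≤ | yes (T , pT , cT<cS) = search bound T pT (ℕ.s≤s⁻¹ (ℕₚ.<-≤-trans cT<cS cS≤))

module Extremal (k e : ℕ) (H : Hypergraph (order (2 ℕ.+ k) (2 ℕ.+ e)) (3 ℕ.+ k))
  (intersecting : Intersecting H) where

  n₀ r₀ m₀ M : ℕ
  n₀ = order (2 ℕ.+ k) (2 ℕ.+ e)
  r₀ = 3 ℕ.+ k
  m₀ = 2 ℕ.+ e
  M = r₀ ℕ.* ((n₀ ∸ 2) C (r₀ ∸ 2))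

  f : Subset n₀ → ℤ
  f = multiplicity (edges H)

  d : Fin n₀ → ℤ
  d v = + deg H v

  f-on : ∀ {S} → S L.∈ edges H → f S ≡ 1ℤ
  f-on = multiplicity-∈ (unique H)

  f-off : ∀ {S} → ¬ (S L.∈ edges H) → f S ≡ 0ℤ
  f-off = multiplicity-∉ (edges H)

  f-level : Level (+ r₀) f
  f-level = multiplicity-Level (edges H) (+ r₀) λ {E} E∈ → trans (size≡∣∣ E) (cong +_ (uniform H E∈))

  f-idem : ∀ S → f S * f S ≡ f S
  f-idem S with S ∈ᴸ? edges H
  ... | yes S∈ = trans (cong (_* f S) (f-on S∈)) (*-identityˡ (f S))
  ... | no S∉ = trans (cong (_* f S) (f-off S∉)) (trans (*-zeroˡ (f S)) (sym (f-off S∉)))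

  -- If `S` is an edge, no edge lies inside its complement, and iterating `up` reads no other sets.
  f-cross : ∀ S → f S * up^ m₀ f (∁ S) ≡ 0ℤ
  f-cross S with S ∈ᴸ? edges H
  ... | no S∉ = trans (cong (_* up^ m₀ f (∁ S)) (f-off S∉)) (*-zeroˡ (up^ m₀ f (∁ S)))
  ... | yes S∈ = trans (cong (λ x → f S * x) (up^-vanish m₀ vanish (∁ S) (λ x → x))) (*-zeroʳ (f S))
    where
    vanish : ∀ E → E ⊆ ∁ S → f E ≡ 0ℤ
    vanish E E⊆ = f-off λ E∈ → let x , x∈ = intersecting S∈ E∈; x∈S , x∈E = x∈p∩q⁻ S E x∈
                               in x∈∁p⇒x∉p (E⊆ x∈E) x∈S

  -- Here `k` is r - 3 and `e` is n - 2r - 2, whereas the parameters of `Spectral` are r - 1 and n -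
  -- 2r.
  open Spectral (suc (suc k)) m₀ f d f-level f-idem (λ w → weight∙multiplicity w (edges H)) f-cross

  degSet≡weight : ∀ S → + degSet H S ≡ weight d S
  degSet≡weight S = sum-filter-∈ (deg H) S S (λ i → i) (λ _ → refl)

  c₂≡ : c₂ ≡ + ((suc (suc k) ℕ.+ suc (suc k) ℕ.+ m₀) C suc k)
  c₂≡ = β≡C _ (suc k)

  c₁-pos : Positive c₁
  c₁-pos = subst Positive (sym (β≡C _ (suc (suc k)))) (positive (+<+ (C-positive _ (suc (suc k))
    (ℕₚ.≤-trans (ℕₚ.m≤m+n _ _) (ℕₚ.≤-trans (ℕₚ.m≤m+n _ m₀) (ℕₚ.n≤1+n _))))))

  module _ (μ : ℕ) (μ≤ : ∀ S → NonEdge H S → μ ℕ.≤ degSet H S) where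
    -- Sum the excess of the degree sum over μ against χ - f, the indicator of the non-edges.
    ore : 0ℤ ≤ ρ * h * c₁ - X - + μ * (c₀ - h)
    ore = begin
      0ℤ ≤⟨ ∑-nonneg pointwise ⟩
      ∑ (λ S → (χ ρ S - f S) * (weight d S - + μ))
        ≡⟨ ∑-cong (λ S → lem₁ (χ ρ S) (f S) (weight d S) (+ μ)) ⟩
      ∑ (λ S → χ ρ S * weight d S + (- 1ℤ * (weight d S * f S) + (- + μ * χ ρ S + + μ * f S)))
        ≡⟨ trans (∑-+ _ _) (cong (λ x → χ ρ ∙ weight d + x) (trans (∑-+ _ _) (cong₂ _+_ (∑-* (- 1ℤ) _)
             (trans (∑-+ _ _) (cong₂ _+_ (∑-* (- + μ) (χ ρ)) (∑-* (+ μ) f)))))) ⟩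
      χ ρ ∙ weight d + (- 1ℤ * weight d ∙ f + (- + μ * c₀ + + μ * h))
        ≡⟨ cong₂ (λ x y → x + (- 1ℤ * y + (- + μ * c₀ + + μ * h)))
             (trans (χ∙weight ρ d) (cong (λ x → x * c₁) total-d)) (weight∙multiplicity d (edges H)) ⟩
      ρ * h * c₁ + (- 1ℤ * X + (- + μ * c₀ + + μ * h)) ≡⟨ lem₂ (ρ * h * c₁) X (+ μ) c₀ h ⟩
      ρ * h * c₁ - X - + μ * (c₀ - h) ∎
      where
      open ≤-Reasoning
      lem₁ : ∀ c f x m → (c - f) * (x - m) ≡ c * x + (- 1ℤ * (x * f) + (- m * c + m * f))
      lem₁ = solve-∀
      lem₂ : ∀ c x m N h → c + (- 1ℤ * x + (- m * N + m * h)) ≡ c - x - m * (N - h)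
      lem₂ = solve-∀
      pointwise : ∀ S → 0ℤ ≤ (χ ρ S - f S) * (weight d S - + μ)
      pointwise S with S ∈ᴸ? edges H | size S ≟ ρ
      ... | yes S∈ | yes size≡ = ≤-reflexive (sym (cong (λ x → (1ℤ - x) * (weight d S - + μ)) (f-on S∈)))
      ... | yes S∈ | no size≢ = contradiction (trans (size≡∣∣ S) (cong +_ (uniform H S∈))) size≢
      ... | no S∉ | no _ = ≤-reflexive (sym (cong (λ x → (0ℤ - x) * (weight d S - + μ)) (f-off S∉)))
      ... | no S∉ | yes size≡ = begin
        0ℤ ≤⟨ i≤j⇒0≤j-i (subst (+ μ ≤_) (degSet≡weight S) (+≤+ (μ≤ S (+-injective (trans (sym (size≡∣∣ S)) size≡) , S∉)))) ⟩
        weight d S - + μ ≡⟨ *-identityˡ _ ⟨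
        1ℤ * (weight d S - + μ) ≡⟨ cong (λ x → (1ℤ - x) * (weight d S - + μ)) (f-off S∉) ⟨
        (1ℤ - f S) * (weight d S - + μ) ∎

    module _ (large : M ℕ.≤ μ) where
      bound≡ : + M ≡ ρ * c₂
      bound≡ = trans (pos-* r₀ ((n₀ ∸ 2) C (r₀ ∸ 2))) (cong (λ x → ρ * x) (sym c₂≡))

      k+m₀≤km : + suc (suc k) + + m₀ ≤ + suc (suc k) * + m₀
      k+m₀≤km = subst (+ (suc (suc k) ℕ.+ m₀) ≤_) (pos-* (suc (suc k)) m₀)
        -- The slack is (k + 1)(e + 1) - 1 = (r - 2)(n - 2r - 1) - 1.
        (+≤+ (subst (suc (suc k) ℕ.+ m₀ ℕ.≤_) (lem k e) (ℕₚ.m≤m+n _ (k ℕ.+ e ℕ.+ k ℕ.* e))))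
        where
        lem : ∀ k e → suc (suc k) ℕ.+ suc (suc e) ℕ.+ (k ℕ.+ e ℕ.+ k ℕ.* e) ≡ suc (suc k) ℕ.* suc (suc e)
        lem = ℕ-Solver.solve-∀

      μ≥ : ρ * c₂ ≤ + μ
      μ≥ = subst (_≤ + μ) bound≡ (+≤+ large)

      instance
        Λ₂-pos : Positive Λ₂
        Λ₂-pos = rising-pos (suc k) m₀
        c₁-pos′ : Positive c₁
        c₁-pos′ = c₁-pos

      μ≡bound : μ ≡ M
      μ≡bound = +-injective (trans (μ≡ρc₂ k+m₀≤km (+ μ) μ≥ ore) (sym bound≡))

      -- On r-sets g = 0 reads a f = -(b + weight), with a > 0. Light vertices are thus those of
      -- high degree.
      f-monotone : ∀ S T → ∣ S ∣ ≡ r₀ → ∣ T ∣ ≡ r₀ → weight w T < weight w S → f S < f T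
      f-monotone S T ∣S∣ ∣T∣ lt = *-cancelˡ-<-nonNeg a {{nonNegative (<⇒≤ (positive⁻¹ a {{a-positive}}))}} (begin-strict
        a * f S ≡⟨ af≡ S ∣S∣ ⟩
        - (b + weight w S) <⟨ neg-mono-< (+-monoʳ-< b lt) ⟩
        - (b + weight w T) ≡⟨ af≡ T ∣T∣ ⟨
        a * f T ∎)
        where
        open ≤-Reasoning
        lem : ∀ x y → x ≡ x + 1ℤ * y - y
        lem = solve-∀
        af≡ : ∀ S → ∣ S ∣ ≡ r₀ → a * f S ≡ - (b + weight w S)
        af≡ S ∣S∣ = begin-equality
          a * f S ≡⟨ lem (a * f S) (b + weight w S) ⟩
          a * f S + 1ℤ * (b + weight w S) - (b + weight w S)
            ≡⟨ cong (λ x → a * f S + x * (b + weight w S) - (b + weight w S)) (χ≡1 S (trans (size≡∣∣ S) (cong +_ ∣S∣))) ⟨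
          a * f S + affine ρ b w S - (b + weight w S)
            ≡⟨ cong (_- (b + weight w S)) (f-affine k+m₀≤km (+ μ) μ≥ ore S) ⟩
          0ℤ - (b + weight w S) ≡⟨ +-identityˡ _ ⟩
          - (b + weight w S) ∎

      separated : ∀ S T → ∣ S ∣ ≡ r₀ → ∣ T ∣ ≡ r₀ → weight w T < weight w S → T L.∈ edges H × ¬ (S L.∈ edges H)
      separated S T ∣S∣ ∣T∣ lt with T ∈ᴸ? edges H | S ∈ᴸ? edges H
      ... | yes T∈ | no S∉ = T∈ , S∉
      ... | yes T∈ | yes S∈ = contradiction (subst₂ _<_ (f-on S∈) (f-on T∈) fS<fT) (<-irrefl refl)
        where fS<fT = f-monotone S T ∣S∣ ∣T∣ lt
      ... | no T∉ | yes S∈ = contradiction (subst₂ _<_ (f-on S∈) (f-off T∉) fS<fT) λ { (+<+ ()) }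
        where fS<fT = f-monotone S T ∣S∣ ∣T∣ lt
      ... | no T∉ | no S∉ = contradiction (subst₂ _<_ (f-off S∉) (f-off T∉) fS<fT) (<-irrefl refl)
        where fS<fT = f-monotone S T ∣S∣ ∣T∣ lt

      is-star : IsOneStar H
      is-star =
        let u , v , wv<wu = nonconstant w total-w (subst (_< 0ℤ) (sym (T-negative k+m₀≤km (+ μ) μ≥ ore))
              (neg-mono-< (positive⁻¹ (q * c₁ * (q * c₁)) {{*-positive (q * c₁) (q * c₁) {{*-positive q c₁}} {{*-positive q c₁}}}})))
        in star H intersecting w (ℕ.s≤s ℕ.z≤n) (subst (suc r₀ ℕ.+ r₀ ℕ.≤_) (lem k e) (ℕₚ.m≤m+n _ (suc e))) separated wv<wu
        where
        lem : ∀ k e → suc (suc (suc (suc k))) ℕ.+ suc (suc (suc k)) ℕ.+ suc e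
                    ≡ suc (suc (suc (suc k) ℕ.+ suc (suc k) ℕ.+ suc (suc e)))
        lem = ℕ-Solver.solve-∀

  oreDegree : Σ ℕ (λ μ → IsOreDegree H μ × μ ℕ.≤ M × (μ ≡ M → IsOneStar H))
  oreDegree with anySubset? (nonEdge? H)
  -- Without non-edges every number is a lower bound; M + 1 would then have to equal M.
  ... | no none = contradiction (μ≡bound _ (λ S nonEdge → contradiction (S , nonEdge) none) (ℕₚ.n≤1+n _)) ℕₚ.1+n≢n
  ... | yes (S₀ , nonEdge₀) with S , nonEdge , least ← minimal (nonEdge? H) (degSet H) S₀ nonEdge₀ =
    degSet H S , ((S , nonEdge , refl) , least) , ≤bound , λ eq → is-star _ least (ℕₚ.≤-reflexive (sym eq))
    where
    ≤bound : degSet H S ℕ.≤ M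
    ≤bound with ℕₚ.≤-total (degSet H S) (M)
    ... | inj₁ p = p
    ... | inj₂ p = ℕₚ.≤-reflexive (μ≡bound _ least p)

2r+2+e≡n : ∀ k e → 2 ℕ.* suc (suc (suc k)) ℕ.+ 2 ℕ.+ e ≡ suc (suc (suc (suc k) ℕ.+ suc (suc k) ℕ.+ suc (suc e)))
2r+2+e≡n = ℕ-Solver.solve-∀

theorem1p4 : (r n : ℕ) → 3 ℕ.≤ r → 2 ℕ.* r ℕ.+ 2 ℕ.≤ n → (H : Hypergraph n r) →
    Intersecting H →
    Σ ℕ (λ m → IsOreDegree H m × m ℕ.≤ r ℕ.* ((n ∸ 2) C (r ∸ 2))
    × (m ≡ r ℕ.* ((n ∸ 2) C (r ∸ 2)) → IsOneStar H))
theorem1p4 (suc (suc (suc k))) n (ℕ.s≤s (ℕ.s≤s (ℕ.s≤s _))) 2r+2≤n H intersecting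
  with e , eq ← ℕₚ.m≤n⇒∃[o]m+o≡n 2r+2≤n
  with refl ← trans (sym eq) (2r+2+e≡n k e) = Extremal.oreDegree k e H intersecting
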